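{- We have $$f_{1110}(x)=\frac{1-5x+8x^2-5x^3+x^4-(1-3x+x^2+2x^3)\sqrt{1-4x+2x^2+x^4}}{2x^2(1-2x)^2}$$ as formal power series in $x$, where $f_{1110}(x)=\sum_{n\ge 0} b_n(1110)x^n$ and $b_n(1110)$ is the number of ascent sequences of length $n$ that avoid both patterns $021$ and $1110$.
   Context: For a finite sequence $w=w_1\cdots w_n$ of integers, $\mathrm{asc}(w)$ is the number of indices $1\le i\le n-1$ with $w_i<w_{i+1}$. An ascent sequence of length $n\ge 1$ is a sequence $a_1\cdots a_n$ of non-negative integers such that $a_1=0$ and $a_i\le \mathrm{asc}(a_1\cdots a_{i-1})+1$ for $1<i\le n$; there is exactly one (empty) ascent sequence of length $0$. A sequence $\pi=\pi_1\cdots\pi_n$ contains a pattern $\tau=\tau_1\cdots\tau_m$ if there are indices $1\le i_1<\cdots<i_m\le n$ such that for all $j,k\in\{1,\dots,m\}$: $\pi_{i_j}<\pi_{i_k}$ iff $\tau_j<\tau_k$, and $\pi_{i_j}=\pi_{i_k}$ iff $\tau_j=\tau_k$; otherwise $\pi$ avoids $\tau$. For a pattern $\tau$, $B_n(\tau)$ is the set of ascent sequences of length $n$ avoiding both $021$ and $\tau$ (with $B_0(\tau)$ consisting of the empty sequence), and $b_n(\tau)=|B_n(\tau)|$. The square root denotes the formal power series square root with constant term $1$. -}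

module Defs where

open import Data.Bool.Base using (true; false; if_then_else_)
open import Data.Fin.Base as Fin using (Fin; toℕ; inject₁; fromℕ)
import Data.Fin.Properties as Fin
open import Data.Integer.Base as ℤ using (ℤ; +_; 0ℤ; 1ℤ)
import Data.Integer.Properties as ℤ
open import Data.List.Base using (List; []; _∷_; length; lookup; take; upTo; filter; cartesianProductWith)
import Data.List.Properties as List
open import Data.List.Membership.Propositional using (_∈_)
open import Data.List.Membership.Propositional.Properties
  using (∈-cartesianProductWith⁺; ∈-filter⁺; ∈-filter⁻; ∈-upTo⁺)
open import Data.List.Relation.Unary.Any using (here)
open import Data.List.Relation.Unary.All using ([])
open import Data.List.Relation.Unary.AllPairs using ([]; _∷_)
open import Data.List.Relation.Unary.Unique.Propositional using (Unique)
import Data.List.Relation.Unary.Unique.Propositional.Properties as Unique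
open import Data.Nat.Base as ℕ using (ℕ; zero; suc; _+_; _∸_; _≤_; _<_; _<ᵇ_; z≤n; s≤s)
import Data.Nat.Properties as ℕ
open import Data.Nat.Induction using (<-rec)
open import Data.Product.Base using (_×_; _,_; proj₁; proj₂; ∃; ∃-syntax)
open import Data.Vec.Base as Vec using (Vec; []; _∷_)
open import Function.Base using (_∘_)
open import Function.Bundles using (_⇔_; mk⇔; Equivalence)
open import Relation.Binary.PropositionalEquality
open import Relation.Nullary.Decidable using (Dec; map′; _×-dec_; _→-dec_; ¬?)
open import Relation.Nullary.Negation using (¬_)
open import Relation.Unary using (Decidable)
open import Algebra.Properties.Semiring.Sum ℤ.+-*-semiring using (sum; sum-cong-≗; sum-init-last)
open import Algebra.Bundles using (AbelianGroup)
open import Algebra.Properties.Group (AbelianGroup.group ℤ.+-0-abelianGroup)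
  using () renaming (∙-cancelʳ to +-cancelʳ)

------------------------------------------------------------------------
-- Ascent sequences

asc : List ℕ → ℕ
asc []          = 0
asc (_ ∷ [])    = 0
asc (x ∷ y ∷ w) = (if x <ᵇ y then 1 else 0) + asc (y ∷ w)

-- Positions are 0-based, so the entries strictly before position i are
-- take (toℕ i) w.
IsAscentSequence : List ℕ → Set
IsAscentSequence w =
  (i : Fin (length w)) →
    (toℕ i ≡ 0 → lookup w i ≡ 0) ×
    (0 < toℕ i → lookup w i ≤ asc (take (toℕ i) w) + 1)

------------------------------------------------------------------------
-- Pattern containment

Increasing : ∀ {m n} → Vec (Fin n) m → Set
Increasing is = ∀ j k → j Fin.< k → Vec.lookup is j Fin.< Vec.lookup is k

OrderIsomorphicAt : (π τ : List ℕ) → Vec (Fin (length π)) (length τ) → Set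
OrderIsomorphicAt π τ is = ∀ j k →
  (lookup π (Vec.lookup is j) < lookup π (Vec.lookup is k) ⇔ lookup τ j < lookup τ k) ×
  (lookup π (Vec.lookup is j) ≡ lookup π (Vec.lookup is k) ⇔ lookup τ j ≡ lookup τ k)

_Contains_ : List ℕ → List ℕ → Set
π Contains τ =
  ∃[ is ] (Increasing {length τ} {length π} is × OrderIsomorphicAt π τ is)

_Avoids_ : List ℕ → List ℕ → Set
π Avoids τ = ¬ (π Contains τ)

B : List ℕ → ℕ → List ℕ → Set
B τ n w =
  length w ≡ n × IsAscentSequence w × w Avoids (0 ∷ 2 ∷ 1 ∷ []) × w Avoids τ

------------------------------------------------------------------------
-- Decidability

private
  ⇔-dec : {P Q : Set} → Dec P → Dec Q → Dec (P ⇔ Q)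
  ⇔-dec P? Q? = map′ (λ (f , g) → mk⇔ f g) (λ e → Equivalence.to e , Equivalence.from e)
                     ((P? →-dec Q?) ×-dec (Q? →-dec P?))

  anyVec? : ∀ {n} m {P : Vec (Fin n) m → Set} → Decidable P → Dec (∃ P)
  anyVec? zero    P? = map′ (λ p → [] , p) (λ { ([] , p) → p }) (P? [])
  anyVec? (suc m) P? =
    map′ (λ (i , is , p) → i ∷ is , p) (λ { (i ∷ is , p) → i , is , p })
         (Fin.any? (λ i → anyVec? m (λ is → P? (i ∷ is))))

isAscentSequence? : Decidable IsAscentSequence
isAscentSequence? w = Fin.all? λ i →
  ((toℕ i ℕ.≟ 0) →-dec (lookup w i ℕ.≟ 0)) ×-dec
  ((0 ℕ.<? toℕ i) →-dec (lookup w i ℕ.≤? asc (take (toℕ i) w) + 1))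

contains? : ∀ π τ → Dec (π Contains τ)
contains? π τ = anyVec? (length τ) λ is →
  (Fin.all? λ j → Fin.all? λ k →
    (j Fin.<? k) →-dec (Vec.lookup is j Fin.<? Vec.lookup is k))
  ×-dec
  (Fin.all? λ j → Fin.all? λ k →
    ⇔-dec (lookup π (Vec.lookup is j) ℕ.<? lookup π (Vec.lookup is k)) (lookup τ j ℕ.<? lookup τ k)
    ×-dec
    ⇔-dec (lookup π (Vec.lookup is j) ℕ.≟ lookup π (Vec.lookup is k)) (lookup τ j ℕ.≟ lookup τ k))

B? : ∀ τ n → Decidable (B τ n)
B? τ n w =
  (length w ℕ.≟ n) ×-dec isAscentSequence? w ×-dec
  ¬? (contains? w (0 ∷ 2 ∷ 1 ∷ [])) ×-dec ¬? (contains? w τ)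

------------------------------------------------------------------------
-- Cardinality

-- All words of length n over the alphabet {0, …, k-1}.
words : ℕ → ℕ → List (List ℕ)
words k zero    = [] ∷ []
words k (suc n) = cartesianProductWith _∷_ (upTo k) (words k n)

-- The entries of an ascent sequence of length n are all smaller than n, so
-- searching words n n loses nothing; see B-list-unique and ∈-B-list.
B-list : List ℕ → ℕ → List (List ℕ)
B-list τ n = filter (B? τ n) (words n n)

b : List ℕ → ℕ → ℕ
b τ n = length (B-list τ n)

private
  words-unique : ∀ k n → Unique (words k n)
  words-unique k zero    = [] ∷ []
  words-unique k (suc n) =
    Unique.cartesianProductWith⁺ _∷_ List.∷-injective (Unique.upTo⁺ k) (words-unique k n)

  ∈-words : ∀ k w → (∀ i → lookup w i < k) → w ∈ words k (length w)
  ∈-words k []      _   = here refl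
  ∈-words k (x ∷ w) w<k =
    ∈-cartesianProductWith⁺ _∷_ (∈-upTo⁺ (w<k Fin.zero)) (∈-words k w (w<k ∘ Fin.suc))

  asc-bound : ∀ x w → asc (x ∷ w) ≤ length w
  asc-bound x []      = z≤n
  asc-bound x (y ∷ w) = ℕ.+-mono-≤ (bit (x <ᵇ y)) (asc-bound y w)
    where
    bit : ∀ c → (if c then 1 else 0) ≤ 1
    bit false = z≤n
    bit true  = s≤s z≤n

  entry-bound : ∀ w → IsAscentSequence w → ∀ i → lookup w i < length w
  entry-bound (x ∷ w) a Fin.zero =
    subst (_< suc (length w)) (sym (proj₁ (a Fin.zero) refl)) (s≤s z≤n)
  entry-bound (x ∷ w) a (Fin.suc i) = s≤s (begin
    lookup w i                        ≤⟨ proj₂ (a (Fin.suc i)) (s≤s z≤n) ⟩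
    asc (x ∷ take (toℕ i) w) + 1      ≤⟨ ℕ.+-monoˡ-≤ 1 (asc-bound x (take (toℕ i) w)) ⟩
    length (take (toℕ i) w) + 1       ≡⟨ cong (_+ 1) (List.length-take (toℕ i) w) ⟩
    (toℕ i ℕ.⊓ length w) + 1          ≤⟨ ℕ.+-monoˡ-≤ 1 (ℕ.m⊓n≤m (toℕ i) (length w)) ⟩
    toℕ i + 1                         ≡⟨ ℕ.+-comm (toℕ i) 1 ⟩
    suc (toℕ i)                       ≤⟨ Fin.toℕ<n i ⟩
    length w                          ∎)
    where open ℕ.≤-Reasoning

B-list-unique : ∀ τ n → Unique (B-list τ n)
B-list-unique τ n = Unique.filter⁺ (B? τ n) (words-unique n n)

∈-B-list : ∀ τ n w → w ∈ B-list τ n ⇔ B τ n w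
∈-B-list τ n w = mk⇔ (proj₂ ∘ ∈-filter⁻ (B? τ n) {xs = words n n}) complete
  where
  complete : B τ n w → w ∈ B-list τ n
  complete p@(refl , a , _) =
    ∈-filter⁺ (B? τ n) (∈-words n w (entry-bound w a)) p

------------------------------------------------------------------------
-- Formal power series with integer coefficients, compared by _≗_

Series : Set
Series = ℕ → ℤ

-- Coefficients are listed in order of increasing degree.
poly : List ℤ → Series
poly []       _       = 0ℤ
poly (c ∷ _)  zero    = c
poly (_ ∷ cs) (suc n) = poly cs n

infixl 6 _⊖_
infixl 7 _⊛_

_⊖_ : Series → Series → Series
(f ⊖ g) n = f n ℤ.- g n

_⊛_ : Series → Series → Series
(f ⊛ g) n = sum {suc n} λ i → f (toℕ i) ℤ.* g (n ∸ toℕ i)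

generatingFunction : (ℕ → ℕ) → Series
generatingFunction a n = + a n

-- f is the quotient p / q.  The divisor need not be invertible in ℤ[[x]];
-- as ℤ[[x]] is an integral domain and q is nonzero, f is determined by p and q.
_IsQuotientOf_By_ : Series → Series → Series → Set
f IsQuotientOf p By q = (∃[ n ] q n ≢ 0ℤ) × (q ⊛ f ≗ p)

-- The square root with constant term 1; it is unique by sqrt-unique.
_IsSqrtOf_ : Series → Series → Set
r IsSqrtOf p = r 0 ≡ 1ℤ × (r ⊛ r ≗ p)

private
  double-cancel : ∀ {x y} → x ℤ.+ x ≡ y ℤ.+ y → x ≡ y
  double-cancel {x} {y} eq = ℤ.*-cancelˡ-≡ (+ 2) x y (trans (twice x) (trans eq (sym (twice y))))
    where
    twice : ∀ z → + 2 ℤ.* z ≡ z ℤ.+ z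
    twice z = trans (ℤ.*-distribʳ-+ z 1ℤ 1ℤ) (cong₂ ℤ._+_ (ℤ.*-identityˡ z) (ℤ.*-identityˡ z))

  middle : Series → ℕ → ℤ
  middle r n = sum {n} λ i → r (suc (toℕ (inject₁ i))) ℤ.* r (n ∸ toℕ (inject₁ i))

  square-suc : ∀ r → r 0 ≡ 1ℤ → ∀ n →
               (r ⊛ r) (suc n) ≡ (r (suc n) ℤ.+ r (suc n)) ℤ.+ middle r n
  square-suc r r0 n = begin
    r 0 ℤ.* x ℤ.+ sum g                       ≡⟨ cong₂ ℤ._+_ (trans (cong (ℤ._* x) r0) (ℤ.*-identityˡ x)) (sum-init-last g) ⟩
    x ℤ.+ (middle r n ℤ.+ g (fromℕ n))        ≡⟨ cong (λ z → x ℤ.+ (middle r n ℤ.+ z)) last-term ⟩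
    x ℤ.+ (middle r n ℤ.+ x)                  ≡⟨ cong (λ z → x ℤ.+ z) (ℤ.+-comm (middle r n) x) ⟩
    x ℤ.+ (x ℤ.+ middle r n)                  ≡⟨ ℤ.+-assoc x x (middle r n) ⟨
    (x ℤ.+ x) ℤ.+ middle r n                  ∎
    where
    open ≡-Reasoning
    x : ℤ
    x = r (suc n)
    g : Fin (suc n) → ℤ
    g i = r (suc (toℕ i)) ℤ.* r (n ∸ toℕ i)
    last-term : g (fromℕ n) ≡ x
    last-term = begin
      g (fromℕ n)                ≡⟨ cong (λ k → r (suc k) ℤ.* r (n ∸ k)) (Fin.toℕ-fromℕ n) ⟩
      x ℤ.* r (n ∸ n)            ≡⟨ cong (λ k → x ℤ.* r k) (ℕ.n∸n≡0 n) ⟩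
      x ℤ.* r 0                  ≡⟨ cong (x ℤ.*_) r0 ⟩
      x ℤ.* 1ℤ                   ≡⟨ ℤ.*-identityʳ x ⟩
      x                          ∎

sqrt-unique : ∀ {p r s} → r IsSqrtOf p → s IsSqrtOf p → r ≗ s
sqrt-unique {p} {r} {s} (r0 , rr) (s0 , ss) = <-rec (λ n → r n ≡ s n) step
  where
  step : ∀ n → (∀ {m} → m < n → r m ≡ s m) → r n ≡ s n
  step zero    _  = trans r0 (sym s0)
  step (suc n) ih = double-cancel (+-cancelʳ (middle r n) _ _ (begin
    (r (suc n) ℤ.+ r (suc n)) ℤ.+ middle r n  ≡⟨ square-suc r r0 n ⟨
    (r ⊛ r) (suc n)                           ≡⟨ trans (rr (suc n)) (sym (ss (suc n))) ⟩
    (s ⊛ s) (suc n)                           ≡⟨ square-suc s s0 n ⟩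
    (s (suc n) ℤ.+ s (suc n)) ℤ.+ middle s n  ≡⟨ cong (λ z → (s (suc n) ℤ.+ s (suc n)) ℤ.+ z) middle-eq ⟨
    (s (suc n) ℤ.+ s (suc n)) ℤ.+ middle r n  ∎))
    where
    open ≡-Reasoning
    middle-eq : middle r n ≡ middle s n
    middle-eq = sum-cong-≗ {n} λ i → cong₂ ℤ._*_
      (ih (s≤s (subst (_< n) (sym (Fin.toℕ-inject₁ i)) (Fin.toℕ<n i))))
      (ih (s≤s (ℕ.m∸n≤m n (toℕ (inject₁ i)))))

{-# OPTIONS --safe #-}

-- An ascent sequence avoids 021 iff its nonzero entries increase weakly, and
-- then it avoids 1110 iff no 0 follows a third copy of a nonzero value.  Hence
-- all that matters about a prefix is its maximum v, whether its last entry is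
-- v or 0, how often v occurs (up to 3), and the excess e of the number of ascents
-- over v, and the sequences are the runs of a transition system on these states.
--
-- The generating functions of the states satisfy, in e, a linear recurrence
-- whose kernel x³λ² - (1-x)(1-2x-x²)λ + (1-x)² has the power series root
-- λ = (1-x)μ with μ = 1 + 2xμ + x²μ + x³μ²; once v is tripled the solution is
-- geometric of ratio ρ = (1-x)/(1-2x).  All of them are combinations of λᵉ and
-- ρᵉ, and 1 - 2x - x² - 2x³μ is the square root of the discriminant.
module Submission where

open import Defs
open import Data.Integer.Base using (+_; -_)
open import Data.List.Base using ([]; _∷_)
open import Data.Product.Base using (_×_; ∃-syntax)

open import Algebra.Bundles using (CommutativeRing)
open import Algebra.Properties.CommutativeSemigroup using (interchange; x∙yz≈y∙xz)
import Algebra.Solver.Ring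
open import Algebra.Solver.Ring.AlmostCommutativeRing
  using (fromCommutativeRing; _-Raw-AlmostCommutative⟶_)
open import Data.Bool.Base using (true; false; if_then_else_)
open import Data.Fin.Base as Fin using (Fin; toℕ)
open import Data.Fin.Patterns using (0F; 1F; 2F; 3F)
open import Data.Integer.Base as ℤ using (ℤ; 0ℤ; 1ℤ)
import Data.Integer.Properties as ℤ
open import Data.List.Base using (List; _++_; map; concatMap; length; lookup; take)
open import Data.List.Membership.Propositional using (_∈_)
open import Data.List.Membership.Propositional.Properties
  using (∈-map⁺; ∈-map⁻; ∈-concatMap⁺; ∈-concatMap⁻)
open import Data.List.Membership.Propositional.Properties.WithK using (unique∧set⇒bag)
import Data.List.Properties as List
open import Data.List.Relation.Binary.BagAndSetEquality using (∼bag⇒↭)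
open import Data.List.Relation.Binary.Disjoint.Propositional using (Disjoint)
open import Data.List.Relation.Binary.Permutation.Propositional.Properties using (↭-length)
open import Data.List.Relation.Binary.Sublist.Propositional
  using (_⊆_; []; _∷_; _∷ʳ_; minimum; ⊆-refl; ⊆-trans)
open import Data.List.Relation.Binary.Sublist.Propositional.Properties
  using (++⁺; ∷⁻; ∷ˡ⁻; length-mono-≤)
open import Data.List.Relation.Unary.All as All using (All; []; _∷_)
import Data.List.Relation.Unary.All.Properties as All
open import Data.List.Relation.Unary.AllPairs as AllPairs using (AllPairs; []; _∷_)
import Data.List.Relation.Unary.AllPairs.Properties as AllPairs
open import Data.List.Relation.Unary.Any as Any using (Any; here; there)
open import Data.List.Relation.Unary.Unique.Propositional using (Unique)
import Data.List.Relation.Unary.Unique.Propositional.Properties as Unique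
open import Data.Maybe.Base as Maybe using (Maybe)
open import Data.Nat.Base as ℕ using (ℕ; zero; suc; _≤_; _<_; _<ᵇ_; z≤n; s≤s)
import Data.Nat.Properties as ℕ
open import Data.Product.Base using (_,_; proj₁; proj₂; map₂)
open import Data.Sum.Base using (inj₁; inj₂)
open import Data.Unit.Base using (⊤; tt)
open import Data.Vec.Base as Vec using (Vec; []; _∷_)
import Data.Vec.Properties as Vec
open import Function.Base using (_∘_; id)
open import Function.Bundles using (_⇔_; mk⇔; Equivalence)
open import Function.Properties.Equivalence using () renaming (refl to ⇔-refl)
open import Relation.Binary.Definitions using (tri<; tri≈; tri>)
open import Relation.Binary.PropositionalEquality
open import Relation.Nullary.Decidable using (dec⇒maybe)
open import Relation.Nullary.Negation using (¬_; contradiction)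

open Equivalence using (to; from)

-- The transition system

-- The maximum so far is suc u, the number of ascents so far is suc u + e, and
-- the last entry is the maximum (max) or 0 (zero).  The subscript counts the
-- occurrences of the maximum; in max₃ it means instead that some nonzero value
-- has occurred three times, which excludes all further zeros.
data State : Set where
  zeros                      : State
  max₁ max₂ max₃ zero₁ zero₂ : (u e : ℕ) → State

-- The entries exceeding the current maximum v, when there are v + e ascents.
jumps : (ℕ → ℕ → State) → ℕ → ℕ → List (ℕ × State)
jumps s v zero    = (suc v , s v zero) ∷ []
jumps s v (suc e) = (suc v , s v (suc e)) ∷ jumps s (suc v) e

-- Returning from 0 to the maximum `v` is an ascent that leaves `v` unchanged, so it raises the
-- excess by 1. A new maximum `x` is also an ascent but lowers the excess by `x - v - 1`. Positive
-- entries below `v` would create 021.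
moves : State → List (ℕ × State)
moves zeros       = (0 , zeros)     ∷ jumps max₁ 0 0
moves (max₁ u e)  = (0 , zero₁ u e) ∷ (suc u , max₂ u e)       ∷ jumps max₁ (suc u) e
moves (max₂ u e)  = (0 , zero₂ u e) ∷ (suc u , max₃ u e)       ∷ jumps max₁ (suc u) e
moves (max₃ u e)  =                   (suc u , max₃ u e)       ∷ jumps max₃ (suc u) e
moves (zero₁ u e) = (0 , zero₁ u e) ∷ (suc u , max₂ u (suc e)) ∷ jumps max₁ (suc u) e
moves (zero₂ u e) = (0 , zero₂ u e) ∷ (suc u , max₃ u (suc e)) ∷ jumps max₁ (suc u) e

-- The generating functions of the states

-- The computation uses only the ring laws and the equations of `μ` and `w`, so it is carried out in
-- any commutative ring with constants from ℤ.
module KernelMethod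
  {c ℓ} (R : CommutativeRing c ℓ)
  (morphism : ℤ.+-*-rawRing -Raw-AlmostCommutative⟶ fromCommutativeRing R)
  where

  open CommutativeRing R
    using (Carrier; _≈_; reflexive; _+_; _*_; 0#; +-cong; +-congˡ; +-congʳ; *-congˡ;
           zeroʳ; +-identityʳ; -‿inverseʳ)
    renaming (-_ to ⊝_; refl to ≈-refl; sym to ≈-sym; trans to ≈-trans)
  open _-Raw-AlmostCommutative⟶_ morphism using () renaming (⟦_⟧ to const)

  private
    const-≟ : ∀ a b → Maybe (const a ≈ const b)
    const-≟ a b = Maybe.map (λ a≡b → reflexive (cong const a≡b)) (dec⇒maybe (a ℤ.≟ b))

  open Algebra.Solver.Ring ℤ.+-*-rawRing (fromCommutativeRing R) morphism const-≟
    using (Polynomial; con; solve; _:=_; _:+_; _:*_; :-_)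

  horner : Carrier → List ℤ → Carrier
  horner x []       = const 0ℤ
  horner x (c ∷ cs) = const c + x * horner x cs

  prepend : ∀ x a {t u} → const 1ℤ + x * t ≈ u → const 1ℤ + x * (a + t) ≈ u + x * a
  prepend x a {t} eq = ≈-trans
    (solve 3 (λ x a t → con 1ℤ :+ x :* (a :+ t) := con 1ℤ :+ x :* t :+ x :* a) ≈-refl x a t)
    (+-congʳ eq)

  -- Inverses and roots enter through their equations: `w` stands for 1/(1-2x), whence `ρ` is
  -- (1-x)/(1-2x), and `μ` is the kernel root divided by 1-x.
  module Solution
    (x μ w : Carrier)
    (μ-eq : μ ≈ const 1ℤ + x * (const (+ 2) * μ + x * μ + x * x * μ * μ))
    (w-eq : w ≈ const 1ℤ + x * (const (+ 2) * w))
    where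

    ρ ƛ : Carrier
    ρ = const 1ℤ + x * w
    ƛ = (const 1ℤ + ⊝ x) * μ

    -- With p = P e and q = Q e below, these are the generating functions in
    -- terms of e; V p q is chosen such that
    -- (1 - x) V (P e) (Q e) = 1 + x Σ_{j ≤ e} G (max₁ _ j).
    V A Z₁ Z₂ : Carrier → Carrier → Carrier
    V p q = p + ⊝ (x * ρ * q)
    A p q = V p q + x * p + x * x * μ * p
    Z₁ p q = V p q + x * μ * p
    Z₂ p q = V p q + x * w * q

    private
      δw δμ : Carrier
      δw = w + ⊝ (const 1ℤ + x * (const (+ 2) * w))
      δμ = μ + ⊝ (const 1ℤ + x * (const (+ 2) * μ + x * μ + x * x * μ * μ))

      -- Equality modulo the defining relations of μ and w, with explicit cofactors.
      modulo : ∀ {f g} a b → f ≈ g + (a * δμ + b * δw) → f ≈ g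
      modulo {g = g} a b eq = ≈-trans eq (≈-trans (+-congˡ (≈-trans
        (+-cong (vanish a μ-eq) (vanish b w-eq)) (+-identityʳ 0#))) (+-identityʳ g))
        where
        vanish : ∀ a {u v} → u ≈ v → a * (u + ⊝ v) ≈ 0#
        vanish a {v = v} u≈v = ≈-trans (*-congˡ (≈-trans (+-congʳ u≈v) (-‿inverseʳ v))) (zeroʳ a)

      -- Syntactic copies for the ring solver: `ini` mirrors `p₀`, `rt` mirrors `root`, and `dm` and
      -- `dw` mirror `δμ` and `δw`.
      module Expr {n} (x m w : Polynomial n) where
        one two rho lam ini dm dw : Polynomial n
        one = con 1ℤ
        two = con (+ 2)
        rho = one :+ x :* w
        lam = (one :+ :- x) :* m
        ini = (one :+ x :* rho) :* m
        dm = m :+ :- (one :+ x :* (two :* m :+ x :* m :+ x :* x :* m :* m))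
        dw = w :+ :- (one :+ x :* (two :* w))

        v a z₁ z₂ : Polynomial n → Polynomial n → Polynomial n
        v p q = p :+ :- (x :* rho :* q)
        a p q = v p q :+ x :* p :+ x :* x :* m :* p
        z₁ p q = v p q :+ x :* m :* p
        z₂ p q = v p q :+ x :* w :* q

        hor : List ℤ → Polynomial n
        hor []       = con 0ℤ
        hor (c ∷ cs) = con c :+ x :* hor cs

        rt : Polynomial n
        rt = hor (+ 1 ∷ - + 2 ∷ - + 1 ∷ []) :+ :- (hor (+ 0 ∷ + 0 ∷ + 0 ∷ + 2 ∷ []) :* m)

    -- The coefficient of the homogeneous solution, fixed by the empty sum being 0.
    p₀ : Carrier
    p₀ = (const 1ℤ + x * ρ) * μ

    -- Together with `sum-q-step` this sums the geometric sequence: 1 + x Σ_{j ≤ e} Q j = (1-x) Q e,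
    -- because (1-2x)ρ = 1-x.
    sum-q-base : const 1ℤ + x * w ≈ (const 1ℤ + ⊝ x) * w
    sum-q-base = modulo (const 0ℤ) (⊝ const 1ℤ) (solve 3 (λ x m w → let open Expr x m w in
      one :+ x :* w := (one :+ :- x) :* w :+ (con 0ℤ :* dm :+ :- one :* dw)) ≈-refl x μ w)

    sum-q-step : ∀ q → (const 1ℤ + ⊝ x) * q + x * (ρ * q) ≈ (const 1ℤ + ⊝ x) * (ρ * q)
    sum-q-step q = modulo (const 0ℤ) (⊝ (x * q)) (solve 4 (λ x m w q → let open Expr x m w in
      (one :+ :- x) :* q :+ x :* (rho :* q) :=
      (one :+ :- x) :* (rho :* q) :+ (con 0ℤ :* dm :+ :- (x :* q) :* dw)) ≈-refl x μ w q)

    sum-a-base : const 1ℤ + x * A p₀ w ≈ (const 1ℤ + ⊝ x) * V p₀ w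
    sum-a-base = modulo (⊝ (const 1ℤ + x * ρ)) (x * ρ) (solve 3 (λ x m w →
      let open Expr x m w in
      one :+ x :* a ini w :=
      (one :+ :- x) :* v ini w :+ (:- (one :+ x :* rho) :* dm :+ x :* rho :* dw)) ≈-refl x μ w)

    -- The part in `p` is the equation of `μ` multiplied by (1-x)p; the part in `q` is `sum-q-step`
    -- multiplied by -xρ. Hence both geometric sequences may be superposed.
    sum-a-step : ∀ p q → (const 1ℤ + ⊝ x) * V p q + x * A (ƛ * p) (ρ * q)
                       ≈ (const 1ℤ + ⊝ x) * V (ƛ * p) (ρ * q)
    sum-a-step p q = modulo (⊝ ((const 1ℤ + ⊝ x) * p)) (x * x * ρ * q)
      (solve 5 (λ x m w p q → let open Expr x m w in
        (one :+ :- x) :* v p q :+ x :* a (lam :* p) (rho :* q) :=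
        (one :+ :- x) :* v (lam :* p) (rho :* q)
          :+ (:- ((one :+ :- x) :* p) :* dm :+ x :* x :* rho :* q :* dw)) ≈-refl x μ w p q)

    -- Serves `zeros` and `max₃`: each has itself as a move, and its jumps account for 1-x times its
    -- generating function.
    zeros-eq : ∀ u → u ≈ (const 1ℤ + ⊝ x) * u + x * u
    zeros-eq u = solve 2 (λ x u → u := (con 1ℤ :+ :- x) :* u :+ x :* u) ≈-refl x u

    -- In the four equations from here on, the term with `V` comes from the jumps and the others
    -- from repeating the maximum and from 0. `V`, `A` and `Z₁` are tailored to them; `zero₂-eq`
    -- rests on ρ = (1-x)w.
    max₁-eq : ∀ p q → A p q ≈ (const 1ℤ + ⊝ x) * V p q + x * p + x * Z₁ p q
    max₁-eq p q = solve 5 (λ x m w p q → let open Expr x m w in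
      a p q := (one :+ :- x) :* v p q :+ x :* p :+ x :* z₁ p q) ≈-refl x μ w p q

    max₂-eq : ∀ p q → p ≈ (const 1ℤ + ⊝ x) * V p q + x * q + x * Z₂ p q
    max₂-eq p q = solve 5 (λ x m w p q → let open Expr x m w in
      p := (one :+ :- x) :* v p q :+ x :* q :+ x :* z₂ p q) ≈-refl x μ w p q

    zero₁-eq : ∀ p q → Z₁ p q ≈ (const 1ℤ + ⊝ x) * V p q + x * (ƛ * p) + x * Z₁ p q
    zero₁-eq p q = solve 5 (λ x m w p q → let open Expr x m w in
      z₁ p q := (one :+ :- x) :* v p q :+ x :* (lam :* p) :+ x :* z₁ p q) ≈-refl x μ w p q

    zero₂-eq : ∀ p q → Z₂ p q ≈ (const 1ℤ + ⊝ x) * V p q + x * (ρ * q) + x * Z₂ p q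
    zero₂-eq p q = modulo (const 0ℤ) (x * q) (solve 5 (λ x m w p q → let open Expr x m w in
      z₂ p q := (one :+ :- x) :* v p q :+ x :* (rho :* q) :+ x :* z₂ p q
        :+ (con 0ℤ :* dm :+ x :* q :* dw)) ≈-refl x μ w p q)

    P Q : ℕ → Carrier
    P zero    = p₀
    P (suc e) = ƛ * P e
    Q zero    = w
    Q (suc e) = ρ * Q e

    -- The maximum is ignored: shifting it along with the number of ascents does not change how many
    -- continuations there are.
    G : State → Carrier
    G zeros       = V (P 0) (Q 0)
    G (max₁ _ e)  = A (P e) (Q e)
    G (max₂ _ e)  = P e
    G (max₃ _ e)  = Q e
    G (zero₁ _ e) = Z₁ (P e) (Q e)
    G (zero₂ _ e) = Z₂ (P e) (Q e)

    total : List (ℕ × State) → Carrier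
    total []             = 0#
    total ((_ , s) ∷ ms) = G s + total ms

    module _ (s : ℕ → ℕ → State) (u : ℕ → Carrier)
      (base : ∀ v → const 1ℤ + x * G (s v 0) ≈ u 0)
      (step : ∀ v e → u e + x * G (s v (suc e)) ≈ u (suc e)) where

      -- The jumps reach each excess from 0 to `e` exactly once, so the sum telescopes along `u`.
      total-jumps : ∀ v e → const 1ℤ + x * total (jumps s v e) ≈ u e
      total-jumps v zero    = ≈-trans (+-congˡ (*-congˡ (+-identityʳ _))) (base v)
      total-jumps v (suc e) =
        ≈-trans (prepend x (G (s v (suc e))) (total-jumps (suc v) e)) (step v e)

    private
      jumps-max₁ : ∀ v e → const 1ℤ + x * total (jumps max₁ v e) ≈ (const 1ℤ + ⊝ x) * V (P e) (Q e)
      jumps-max₁ = total-jumps max₁ (λ e → (const 1ℤ + ⊝ x) * V (P e) (Q e))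
        (λ _ → sum-a-base) (λ _ e → sum-a-step (P e) (Q e))

      jumps-max₃ : ∀ v e → const 1ℤ + x * total (jumps max₃ v e) ≈ (const 1ℤ + ⊝ x) * Q e
      jumps-max₃ = total-jumps max₃ (λ e → (const 1ℤ + ⊝ x) * Q e)
        (λ _ → sum-q-base) (λ _ e → sum-q-step (Q e))

    -- The linear system of the states: the empty continuation contributes 1, and each move a factor
    -- x.
    G-unfold : ∀ s → G s ≈ const 1ℤ + x * total (moves s)
    G-unfold s@zeros       = ≈-trans (zeros-eq (G s)) (≈-sym (prepend x (G s) (jumps-max₁ 0 0)))
    G-unfold s@(max₁ u e)  = ≈-trans (max₁-eq (P e) (Q e))
      (≈-sym (prepend x (G (zero₁ u e)) (prepend x (G (max₂ u e)) (jumps-max₁ (suc u) e))))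
    G-unfold s@(max₂ u e)  = ≈-trans (max₂-eq (P e) (Q e))
      (≈-sym (prepend x (G (zero₂ u e)) (prepend x (G (max₃ u e)) (jumps-max₁ (suc u) e))))
    G-unfold s@(max₃ u e)  = ≈-trans (zeros-eq (G s)) (≈-sym (prepend x (G s) (jumps-max₃ (suc u) e)))
    G-unfold s@(zero₁ u e) = ≈-trans (zero₁-eq (P e) (Q e))
      (≈-sym (prepend x (G s) (prepend x (G (max₂ u (suc e))) (jumps-max₁ (suc u) e))))
    G-unfold s@(zero₂ u e) = ≈-trans (zero₂-eq (P e) (Q e))
      (≈-sym (prepend x (G s) (prepend x (G (max₃ u (suc e))) (jumps-max₁ (suc u) e))))

    root : Carrier
    root = horner x (+ 1 ∷ - + 2 ∷ - + 1 ∷ []) + ⊝ (horner x (+ 0 ∷ + 0 ∷ + 0 ∷ + 2 ∷ []) * μ)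

    -- Completing the square in the equation of `μ` leaves the discriminant (1-2x-x²)² - 4x³.
    root-square : root * root ≈ horner x (+ 1 ∷ - + 4 ∷ + 2 ∷ + 0 ∷ + 1 ∷ [])
    root-square = modulo (horner x (+ 0 ∷ + 0 ∷ + 0 ∷ - + 4 ∷ [])) (const 0ℤ)
      (solve 3 (λ x m w → let open Expr x m w in
        rt :* rt := hor (+ 1 ∷ - + 4 ∷ + 2 ∷ + 0 ∷ + 1 ∷ [])
          :+ (hor (+ 0 ∷ + 0 ∷ + 0 ∷ - + 4 ∷ []) :* dm :+ con 0ℤ :* dw)) ≈-refl x μ w)

    -- Both sides are linear in `μ`; once the factor (1-2x)² has cleared the denominators of `ρ` and
    -- `w`, they agree by (1-2x)w = 1.
    quotient-eq :
      horner x (+ 0 ∷ + 0 ∷ + 2 ∷ []) * (horner x (+ 1 ∷ - + 2 ∷ []) * horner x (+ 1 ∷ - + 2 ∷ []))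
        * (const 1ℤ + x * V p₀ w)
      ≈ horner x (+ 1 ∷ - + 5 ∷ + 8 ∷ - + 5 ∷ + 1 ∷ [])
        + ⊝ (horner x (+ 1 ∷ - + 3 ∷ + 1 ∷ + 2 ∷ []) * root)
    quotient-eq = modulo (const 0ℤ)
      (horner x (+ 0 ∷ + 0 ∷ + 0 ∷ + 2 ∷ [])
        * (horner x (+ 0 ∷ + 0 ∷ + 1 ∷ - + 2 ∷ []) * (μ + ⊝ w)
          + ⊝ (horner x (+ 0 ∷ + 1 ∷ - + 1 ∷ []))))
      (solve 3 (λ x m w → let open Expr x m w in
        hor (+ 0 ∷ + 0 ∷ + 2 ∷ []) :* (hor (+ 1 ∷ - + 2 ∷ []) :* hor (+ 1 ∷ - + 2 ∷ []))
          :* (con 1ℤ :+ x :* v ini w)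
        := hor (+ 1 ∷ - + 5 ∷ + 8 ∷ - + 5 ∷ + 1 ∷ [])
          :+ :- (hor (+ 1 ∷ - + 3 ∷ + 1 ∷ + 2 ∷ []) :* rt)
          :+ (con 0ℤ :* dm :+ hor (+ 0 ∷ + 0 ∷ + 0 ∷ + 2 ∷ [])
            :* (hor (+ 0 ∷ + 0 ∷ + 1 ∷ - + 2 ∷ []) :* (m :+ :- w)
              :+ :- (hor (+ 0 ∷ + 1 ∷ - + 1 ∷ []))) :* dw))
        ≈-refl x μ w)

-- The ring of formal power series

infixl 6 _⊕_

_⊕_ : Series → Series → Series
(f ⊕ g) n = f n ℤ.+ g n

⊝_ : Series → Series
(⊝ f) n = ℤ.- f n

const : ℤ → Series
const c = poly (c ∷ [])

X : Series
X = poly (0ℤ ∷ 1ℤ ∷ [])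

tail : Series → Series
tail f = f ∘ suc

-- The bounds on the degrees are what makes recursive definitions of series well founded below.
⊛-cong-≤ : ∀ n {f f′ g g′} → (∀ {m} → m ≤ n → f m ≡ f′ m) → (∀ {m} → m ≤ n → g m ≡ g′ m) →
           (f ⊛ g) n ≡ (f′ ⊛ g′) n
⊛-cong-≤ zero    ff gg = cong (ℤ._+ 0ℤ) (cong₂ ℤ._*_ (ff z≤n) (gg z≤n))
⊛-cong-≤ (suc n) ff gg = cong₂ ℤ._+_ (cong₂ ℤ._*_ (ff z≤n) (gg ℕ.≤-refl))
  (⊛-cong-≤ n (ff ∘ s≤s) (gg ∘ ℕ.m≤n⇒m≤1+n))

⊛-congˡ-≤ : ∀ f n {g g′} → (∀ {m} → m ≤ n → g m ≡ g′ m) → (f ⊛ g) n ≡ (f ⊛ g′) n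
⊛-congˡ-≤ f n = ⊛-cong-≤ n {f} (λ _ → refl)

⊛-cong : ∀ {f f′ g g′} → f ≗ f′ → g ≗ g′ → f ⊛ g ≗ f′ ⊛ g′
⊛-cong ff gg n = ⊛-cong-≤ n (λ {m} _ → ff m) (λ {m} _ → gg m)

private
  +-interchange = interchange ℤ.+-commutativeSemigroup

⊛-distribʳ-⊕ : ∀ h f g → (f ⊕ g) ⊛ h ≗ f ⊛ h ⊕ g ⊛ h
⊛-distribʳ-⊕ h f g zero    =
  trans (cong (ℤ._+ 0ℤ) (ℤ.*-distribʳ-+ (h 0) (f 0) (g 0)))
    (+-interchange (f 0 ℤ.* h 0) (g 0 ℤ.* h 0) 0ℤ 0ℤ)
⊛-distribʳ-⊕ h f g (suc n) = trans
  (cong₂ ℤ._+_ (ℤ.*-distribʳ-+ (h (suc n)) (f 0) (g 0)) (⊛-distribʳ-⊕ h (tail f) (tail g) n))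
  (+-interchange (f 0 ℤ.* h (suc n)) (g 0 ℤ.* h (suc n)) ((tail f ⊛ h) n) ((tail g ⊛ h) n))

scaled-⊛ : ∀ c f g → (λ n → c ℤ.* f n) ⊛ g ≗ (λ n → c ℤ.* (f ⊛ g) n)
scaled-⊛ c f g zero    = begin
  c ℤ.* f 0 ℤ.* g 0 ℤ.+ 0ℤ    ≡⟨ ℤ.+-identityʳ _ ⟩
  c ℤ.* f 0 ℤ.* g 0           ≡⟨ ℤ.*-assoc c (f 0) (g 0) ⟩
  c ℤ.* (f 0 ℤ.* g 0)         ≡⟨ cong (c ℤ.*_) (ℤ.+-identityʳ _) ⟨
  c ℤ.* (f 0 ℤ.* g 0 ℤ.+ 0ℤ)  ∎
  where open ≡-Reasoning
scaled-⊛ c f g (suc n) = trans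
  (cong₂ ℤ._+_ (ℤ.*-assoc c (f 0) (g (suc n))) (scaled-⊛ c (tail f) g n))
  (sym (ℤ.*-distribˡ-+ c _ _))

-- The tail of `f ⊛ g` is `f 0` times `tail g` plus `tail f ⊛ g`, which allows induction on the
-- degree.
⊛-assoc : ∀ f g h → (f ⊛ g) ⊛ h ≗ f ⊛ (g ⊛ h)
⊛-assoc f g h zero = cong (ℤ._+ 0ℤ) (begin
  (f 0 ℤ.* g 0 ℤ.+ 0ℤ) ℤ.* h 0  ≡⟨ cong (ℤ._* h 0) (ℤ.+-identityʳ (f 0 ℤ.* g 0)) ⟩
  f 0 ℤ.* g 0 ℤ.* h 0           ≡⟨ ℤ.*-assoc (f 0) (g 0) (h 0) ⟩
  f 0 ℤ.* (g 0 ℤ.* h 0)         ≡⟨ cong (f 0 ℤ.*_) (ℤ.+-identityʳ _) ⟨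
  f 0 ℤ.* (g 0 ℤ.* h 0 ℤ.+ 0ℤ)  ∎)
  where open ≡-Reasoning
⊛-assoc f g h (suc n) = begin
  (f ⊛ g) 0 ℤ.* h (suc n) ℤ.+ (tail (f ⊛ g) ⊛ h) n
    ≡⟨ cong₂ ℤ._+_ (trans (cong (ℤ._* h (suc n)) (ℤ.+-identityʳ (f 0 ℤ.* g 0)))
                          (ℤ.*-assoc (f 0) (g 0) (h (suc n))))
                   (trans (⊛-distribʳ-⊕ h (λ m → f 0 ℤ.* tail g m) (tail f ⊛ g) n)
                          (cong₂ ℤ._+_ (scaled-⊛ (f 0) (tail g) h n) (⊛-assoc (tail f) g h n))) ⟩
  f 0 ℤ.* (g 0 ℤ.* h (suc n)) ℤ.+ (f 0 ℤ.* (tail g ⊛ h) n ℤ.+ (tail f ⊛ (g ⊛ h)) n)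
    ≡⟨ ℤ.+-assoc (f 0 ℤ.* (g 0 ℤ.* h (suc n))) _ _ ⟨
  f 0 ℤ.* (g 0 ℤ.* h (suc n)) ℤ.+ f 0 ℤ.* (tail g ⊛ h) n ℤ.+ (tail f ⊛ (g ⊛ h)) n
    ≡⟨ cong (ℤ._+ (tail f ⊛ (g ⊛ h)) n) (ℤ.*-distribˡ-+ (f 0) (g 0 ℤ.* h (suc n)) ((tail g ⊛ h) n)) ⟨
  f 0 ℤ.* (g ⊛ h) (suc n) ℤ.+ (tail f ⊛ (g ⊛ h)) n ∎
  where open ≡-Reasoning

-- Peels off a coefficient of the right factor, whereas `_⊛_` computes by peeling the left one;
-- commutativity follows by induction.
⊛-suc′ : ∀ f g n → (f ⊛ g) (suc n) ≡ g 0 ℤ.* f (suc n) ℤ.+ (f ⊛ tail g) n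
⊛-suc′ f g zero    = begin
  f 0 ℤ.* g 1 ℤ.+ (f 1 ℤ.* g 0 ℤ.+ 0ℤ)  ≡⟨ x∙yz≈y∙xz ℤ.+-commutativeSemigroup (f 0 ℤ.* g 1) (f 1 ℤ.* g 0) 0ℤ ⟩
  f 1 ℤ.* g 0 ℤ.+ (f 0 ℤ.* g 1 ℤ.+ 0ℤ)  ≡⟨ cong (ℤ._+ (f ⊛ tail g) 0) (ℤ.*-comm (f 1) (g 0)) ⟩
  g 0 ℤ.* f 1 ℤ.+ (f 0 ℤ.* g 1 ℤ.+ 0ℤ)  ∎
  where open ≡-Reasoning
⊛-suc′ f g (suc n) = trans
  (cong (λ z → f 0 ℤ.* g (suc (suc n)) ℤ.+ z) (⊛-suc′ (tail f) g n))
  (x∙yz≈y∙xz ℤ.+-commutativeSemigroup (f 0 ℤ.* g (suc (suc n)))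
    (g 0 ℤ.* f (suc (suc n))) ((tail f ⊛ tail g) n))

⊛-comm : ∀ f g → f ⊛ g ≗ g ⊛ f
⊛-comm f g zero    = cong (ℤ._+ 0ℤ) (ℤ.*-comm (f 0) (g 0))
⊛-comm f g (suc n) = trans (⊛-suc′ f g n)
  (cong (λ z → g 0 ℤ.* f (suc n) ℤ.+ z) (⊛-comm f (tail g) n))

poly-[]-⊛ : ∀ f → poly [] ⊛ f ≗ poly []
poly-[]-⊛ f zero    = refl
poly-[]-⊛ f (suc n) = trans (ℤ.+-identityˡ _) (poly-[]-⊛ f n)

const-⊛ : ∀ c f → const c ⊛ f ≗ λ n → c ℤ.* f n
const-⊛ c f zero    = ℤ.+-identityʳ _
const-⊛ c f (suc n) = trans (cong (λ z → c ℤ.* f (suc n) ℤ.+ z) (poly-[]-⊛ f n)) (ℤ.+-identityʳ _)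

⊛-identityˡ : ∀ f → const 1ℤ ⊛ f ≗ f
⊛-identityˡ f n = trans (const-⊛ 1ℤ f n) (ℤ.*-identityˡ _)

X-⊛-suc : ∀ f n → (X ⊛ f) (suc n) ≡ f n
X-⊛-suc f n = trans (ℤ.+-identityˡ _) (⊛-identityˡ f n)

⊛-⊕-commutativeRing : CommutativeRing _ _
⊛-⊕-commutativeRing = record
  { Carrier = Series
  ; _≈_ = _≗_
  ; _+_ = _⊕_
  ; _*_ = _⊛_
  ; -_ = ⊝_
  ; 0# = poly []
  ; 1# = const 1ℤ
  ; isCommutativeRing = record
    { isRing = record
      { +-isAbelianGroup = record
        { isGroup = record
          { isMonoid = record
            { isSemigroup = record
              { isMagma = record
                { isEquivalence = record
                  { refl = λ _ → refl
                  ; sym = λ e n → sym (e n)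
                  ; trans = λ e e′ n → trans (e n) (e′ n)
                  }
                ; ∙-cong = λ e e′ n → cong₂ ℤ._+_ (e n) (e′ n)
                }
              ; assoc = λ f g h n → ℤ.+-assoc (f n) (g n) (h n)
              }
            ; identity = (λ f n → ℤ.+-identityˡ (f n)) , (λ f n → ℤ.+-identityʳ (f n))
            }
          ; inverse = (λ f n → ℤ.+-inverseˡ (f n)) , (λ f n → ℤ.+-inverseʳ (f n))
          ; ⁻¹-cong = λ e n → cong ℤ.-_ (e n)
          }
        ; comm = λ f g n → ℤ.+-comm (f n) (g n)
        }
      ; *-cong = ⊛-cong
      ; *-assoc = ⊛-assoc
      ; *-identity = ⊛-identityˡ , (λ f n → trans (⊛-comm f (const 1ℤ) n) (⊛-identityˡ f n))
      ; distrib = (λ f g h n → trans (⊛-comm f (g ⊕ h) n) (trans (⊛-distribʳ-⊕ f g h n)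
                                 (cong₂ ℤ._+_ (⊛-comm g f n) (⊛-comm h f n))))
                , ⊛-distribʳ-⊕
      }
    ; *-comm = ⊛-comm
    }
  }

const-morphism : ℤ.+-*-rawRing -Raw-AlmostCommutative⟶ fromCommutativeRing ⊛-⊕-commutativeRing
const-morphism = record
  { ⟦_⟧ = const
  ; +-homo = λ { a b zero → refl ; a b (suc n) → refl }
  ; *-homo = λ { a b zero → sym (ℤ.+-identityʳ _)
               ; a b (suc n) → sym (trans (const-⊛ a (const b) (suc n)) (ℤ.*-zeroʳ a)) }
  ; -‿homo = λ { a zero → refl ; a (suc n) → refl }
  ; 0-homo = λ { zero → refl ; (suc n) → refl }
  ; 1-homo = λ _ → refl
  }

poly-∷ : ∀ c cs → poly (c ∷ cs) ≗ const c ⊕ X ⊛ poly cs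
poly-∷ c cs zero    = sym (trans (cong (λ z → c ℤ.+ z) (ℤ.+-identityʳ _)) (ℤ.+-identityʳ c))
poly-∷ c cs (suc n) = sym (trans (ℤ.+-identityˡ _) (X-⊛-suc (poly cs) n))

-- Power series defined by guarded recursion

module Guarded (H : Series → Series)
  (H-cong-≤ : ∀ n {f g} → (∀ {m} → m ≤ n → f m ≡ g m) → H f n ≡ H g n) where

  private
    F : Series → Series
    F f = const 1ℤ ⊕ X ⊛ H f

    F-cong-< : ∀ n {f g} → (∀ {m} → m < n → f m ≡ g m) → F f n ≡ F g n
    F-cong-< zero            _  = refl
    F-cong-< (suc n) {f} {g} fg = cong (λ z → 0ℤ ℤ.+ z)
      (trans (X-⊛-suc (H f) n) (trans (H-cong-≤ n (fg ∘ s≤s)) (sym (X-⊛-suc (H g) n))))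

    approx : ℕ → Series
    approx zero    = poly []
    approx (suc k) = F (approx k)

    -- A coefficient of `F f` depends only on lower coefficients of `f`, so each iteration settles
    -- one more; `fixpoint` can therefore read coefficient `n` off iterate `n + 1`.
    approx-stable : ∀ {k l} m → m < k → m < l → approx k m ≡ approx l m
    approx-stable {suc k} {suc l} m (s≤s m≤k) (s≤s m≤l) = F-cong-< m λ {j} j<m →
      approx-stable j (ℕ.<-≤-trans j<m m≤k) (ℕ.<-≤-trans j<m m≤l)

  fixpoint : Series
  fixpoint n = approx (suc n) n

  fixpoint-unfold : fixpoint ≗ F fixpoint
  fixpoint-unfold n = F-cong-< n λ {m} m<n → approx-stable m m<n ℕ.≤-refl

private
  module w-def = Guarded (λ f → const (+ 2) ⊛ f)
    (λ n → ⊛-congˡ-≤ (const (+ 2)) n)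

  module μ-def = Guarded (λ f → const (+ 2) ⊛ f ⊕ X ⊛ f ⊕ X ⊛ X ⊛ f ⊛ f)
    (λ n {f} {g} fg → cong₂ ℤ._+_
      (cong₂ ℤ._+_ (⊛-congˡ-≤ (const (+ 2)) n fg) (⊛-congˡ-≤ X n fg))
      (⊛-cong-≤ n {X ⊛ X ⊛ f} {X ⊛ X ⊛ g}
        (λ {m} m≤n → ⊛-congˡ-≤ (X ⊛ X) m (λ k≤m → fg (ℕ.≤-trans k≤m m≤n))) fg))

open KernelMethod ⊛-⊕-commutativeRing const-morphism using (horner; module Solution)
open Solution X μ-def.fixpoint w-def.fixpoint μ-def.fixpoint-unfold w-def.fixpoint-unfold

open CommutativeRing ⊛-⊕-commutativeRing using ()
  renaming (trans to ≗-trans; *-congˡ to ⊛-congˡ; +-congˡ to ⊕-congˡ)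

-- Enumeration of the runs and their number

runs : State → ℕ → List (List ℕ)
runs s zero    = [] ∷ []
runs s (suc n) = concatMap (λ (x , t) → map (x ∷_) (runs t n)) (moves s)

branch : ℕ → ℕ × State → List (List ℕ)
branch n (x , t) = map (x ∷_) (runs t n)

-- The factor x in `G-unfold` turns it into a recurrence on the degree, the same one that `runs`
-- follows by construction.
length-runs : ∀ s n → + length (runs s n) ≡ G s n
length-runs s zero    = sym (G-unfold s 0)
length-runs s (suc n) = begin
  + length (runs s (suc n))             ≡⟨ branches (moves s) ⟩
  total (moves s) n                     ≡⟨ X-⊛-suc (total (moves s)) n ⟨
  (X ⊛ total (moves s)) (suc n)         ≡⟨ ℤ.+-identityˡ _ ⟨
  0ℤ ℤ.+ (X ⊛ total (moves s)) (suc n)  ≡⟨ G-unfold s (suc n) ⟨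
  G s (suc n)                           ∎
  where
  open ≡-Reasoning
  branches : ∀ ms → + length (concatMap (branch n) ms) ≡ total ms n
  branches []             = refl
  branches ((x , t) ∷ ms) = begin
    + length (map (x ∷_) (runs t n) ++ rest)
      ≡⟨ cong +_ (List.length-++ (map (x ∷_) (runs t n))) ⟩
    + (length (map (x ∷_) (runs t n)) ℕ.+ length rest)
      ≡⟨ cong (λ k → + (k ℕ.+ length rest)) (List.length-map (x ∷_) (runs t n)) ⟩
    + length (runs t n) ℤ.+ + length rest
      ≡⟨ cong₂ ℤ._+_ (length-runs t n) (branches ms) ⟩
    G t n ℤ.+ total ms n ∎
    where rest = concatMap (branch n) ms

-- The square root and the quotient as series

poly-horner : ∀ cs → poly cs ≗ horner X cs
poly-horner []       zero    = refl
poly-horner []       (suc n) = refl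
poly-horner (c ∷ cs) = ≗-trans (poly-∷ c cs) (⊕-congˡ {const c} (⊛-congˡ {X} (poly-horner cs)))

root-isSqrt : root IsSqrtOf poly (+ 1 ∷ - + 4 ∷ + 2 ∷ + 0 ∷ + 1 ∷ [])
root-isSqrt = refl , λ n → trans (root-square n)
  (sym (poly-horner (+ 1 ∷ - + 4 ∷ + 2 ∷ + 0 ∷ + 1 ∷ []) n))

isQuotient : ∀ f → f ≗ const 1ℤ ⊕ X ⊛ G zeros →
  f IsQuotientOf
      (poly (+ 1 ∷ - + 5 ∷ + 8 ∷ - + 5 ∷ + 1 ∷ [])
        ⊖ poly (+ 1 ∷ - + 3 ∷ + 1 ∷ + 2 ∷ []) ⊛ root)
    By
      (poly (+ 0 ∷ + 0 ∷ + 2 ∷ [])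
        ⊛ (poly (+ 1 ∷ - + 2 ∷ []) ⊛ poly (+ 1 ∷ - + 2 ∷ [])))
-- The divisor is nonzero since it begins with 2x².
isQuotient f f≗ = (2 , λ ()) , λ n → trans
  (⊛-cong (⊛-cong (poly-horner (+ 0 ∷ + 0 ∷ + 2 ∷ []))
                  (⊛-cong (poly-horner (+ 1 ∷ - + 2 ∷ [])) (poly-horner (+ 1 ∷ - + 2 ∷ []))))
          f≗ n)
  (trans (quotient-eq n)
    (sym (cong₂ ℤ._-_ (poly-horner (+ 1 ∷ - + 5 ∷ + 8 ∷ - + 5 ∷ + 1 ∷ []) n)
      (⊛-cong {g = root} (poly-horner (+ 1 ∷ - + 3 ∷ + 1 ∷ + 2 ∷ [])) (λ _ → refl) n))))

-- Pattern containment through sublists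

increasing-tail : ∀ {m n} {i : Fin n} {is : Vec (Fin n) m} → Increasing (i ∷ is) → Increasing is
increasing-tail inc j k j<k = inc (Fin.suc j) (Fin.suc k) (s≤s j<k)

increasing-map-suc : ∀ {m n} (is : Vec (Fin n) m) → Increasing is → Increasing (Vec.map Fin.suc is)
increasing-map-suc is inc j k j<k
  rewrite Vec.lookup-map j Fin.suc is | Vec.lookup-map k Fin.suc is = s≤s (inc j k j<k)

increasing-map-suc⁻ : ∀ {m n} (is : Vec (Fin n) m) → Increasing (Vec.map Fin.suc is) → Increasing is
increasing-map-suc⁻ is inc j k j<k
  with p ← inc j k j<k rewrite Vec.lookup-map j Fin.suc is | Vec.lookup-map k Fin.suc is = ℕ.s<s⁻¹ p

all-suc : ∀ {m n} (is : Vec (Fin (suc n)) m) → (∀ j → 0 < toℕ (Vec.lookup is j)) →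
          ∃[ js ] is ≡ Vec.map Fin.suc js
all-suc []               _   = [] , refl
all-suc (Fin.zero  ∷ is) pos = contradiction (pos Fin.zero) λ ()
all-suc (Fin.suc i ∷ is) pos with js , refl ← all-suc is (pos ∘ Fin.suc) = i ∷ js , refl

entries : (π : List ℕ) → ∀ {m} → Vec (Fin (length π)) m → List ℕ
entries π = Vec.toList ∘ Vec.map (lookup π)

entries-suc : ∀ x π {m} (is : Vec (Fin (length π)) m) →
              entries (x ∷ π) (Vec.map Fin.suc is) ≡ entries π is
entries-suc x π is = cong Vec.toList (sym (Vec.map-∘ (lookup (x ∷ π)) Fin.suc is))

-- Among increasing positions only the first can be 0, so all the others are positions in the tail.
entries-⊆ : ∀ π {m} (is : Vec (Fin (length π)) m) → Increasing is → entries π is ⊆ π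
entries-⊆ π       []               _   = minimum π
entries-⊆ (x ∷ π) (Fin.zero  ∷ is) inc
  with js , refl ← all-suc is (λ j → inc Fin.zero (Fin.suc j) (s≤s z≤n)) =
  refl ∷ subst (_⊆ π) (sym (entries-suc x π js))
    (entries-⊆ π js (increasing-map-suc⁻ js (increasing-tail inc)))
entries-⊆ (x ∷ π) (Fin.suc i ∷ is) inc
  with js , refl ← all-suc is (λ j → ℕ.≤-<-trans z≤n (inc Fin.zero (Fin.suc j) (s≤s z≤n))) =
  x ∷ʳ subst (_⊆ π) (cong (lookup π i ∷_) (sym (entries-suc x π js)))
    (entries-⊆ π (i ∷ js) (increasing-map-suc⁻ (i ∷ js) inc))

-- An occurrence of τ is an image of τ under an increasing map.
module _ (φ : ℕ → ℕ) (φ-suc : ∀ n → φ n < φ (suc n)) where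

  φ-mono-< : ∀ {m n} → m < n → φ m < φ n
  φ-mono-< {m} {suc n} (s≤s m≤n) with ℕ.m≤n⇒m<n∨m≡n m≤n
  ... | inj₁ m<n  = ℕ.<-trans (φ-mono-< m<n) (φ-suc n)
  ... | inj₂ refl = φ-suc n

  φ-cancel-< : ∀ {m n} → φ m < φ n → m < n
  φ-cancel-< {m} {n} lt with ℕ.<-cmp m n
  ... | tri< m<n _ _  = m<n
  ... | tri≈ _ refl _ = contradiction lt (ℕ.<-irrefl refl)
  ... | tri> _ _ n<m  = contradiction lt (ℕ.<-asym (φ-mono-< n<m))

  φ-injective : ∀ {m n} → φ m ≡ φ n → m ≡ n
  φ-injective {m} {n} eq with ℕ.<-cmp m n
  ... | tri< m<n _ _  = contradiction eq (ℕ.<⇒≢ (φ-mono-< m<n))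
  ... | tri≈ _ m≡n _  = m≡n
  ... | tri> _ _ n<m  = contradiction (sym eq) (ℕ.<⇒≢ (φ-mono-< n<m))

  map-⊆-positions : ∀ τ {π} → map φ τ ⊆ π → ∃[ is ] (Increasing {length τ} {length π} is ×
                    (∀ j → lookup π (Vec.lookup is j) ≡ φ (lookup τ j)))
  map-⊆-positions []      _        = [] , (λ ()) , λ ()
  map-⊆-positions (t ∷ τ) (y ∷ʳ p) with is , inc , eq ← map-⊆-positions (t ∷ τ) p =
    Vec.map Fin.suc is , increasing-map-suc is inc ,
    λ j → trans (cong (lookup (y ∷ _)) (Vec.lookup-map j Fin.suc is)) (eq j)
  map-⊆-positions (t ∷ τ) (refl ∷ p) with is , inc , eq ← map-⊆-positions τ p =
    Fin.zero ∷ Vec.map Fin.suc is ,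
    (λ { Fin.zero (Fin.suc k) _ →
           subst (λ i → 0 < toℕ i) (sym (Vec.lookup-map k Fin.suc is)) (s≤s z≤n)
       ; (Fin.suc j) (Fin.suc k) (s≤s j<k) → increasing-map-suc is inc j k j<k }) ,
    λ { Fin.zero → refl
      ; (Fin.suc j) → trans (cong (lookup (φ t ∷ _)) (Vec.lookup-map j Fin.suc is)) (eq j) }

  map-⊆⇒Contains : ∀ τ {π} → map φ τ ⊆ π → π Contains τ
  map-⊆⇒Contains τ p with is , inc , eq ← map-⊆-positions τ p =
    is , inc , λ j k →
      mk⇔ (φ-cancel-< ∘ subst₂ _<_ (eq j) (eq k)) (subst₂ _<_ (sym (eq j)) (sym (eq k)) ∘ φ-mono-<) ,
      mk⇔ (λ p → φ-injective (trans (sym (eq j)) (trans p (eq k))))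
          (λ p → trans (eq j) (trans (cong φ p) (sym (eq k))))

-- The two patterns behind a leading 0

Noninversion : List ℕ → Set
Noninversion w = ∀ {b c} → 0 < c → c < b → ¬ (b ∷ c ∷ []) ⊆ w

Nontriple : List ℕ → Set
Nontriple w = ∀ {x y} → y < x → ¬ (x ∷ x ∷ x ∷ y ∷ []) ⊆ w

contains-021 : ∀ {a b c π} → a < c → c < b → (a ∷ b ∷ c ∷ []) ⊆ π → π Contains (0 ∷ 2 ∷ 1 ∷ [])
contains-021 {a} {b} {c} a<c c<b p = map-⊆⇒Contains φ φ-suc (0 ∷ 2 ∷ 1 ∷ [])
  (subst (λ z → (a ∷ z ∷ c ∷ []) ⊆ _) (sym (ℕ.+-identityʳ b)) p)
  where
  -- The letters 0, 1, 2 go to `a`, `c`, `b`; the values beyond 2 merely continue the map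
  -- increasingly.
  φ : ℕ → ℕ
  φ 0             = a
  φ 1             = c
  φ (suc (suc n)) = b ℕ.+ n
  φ-suc : ∀ n → φ n < φ (suc n)
  φ-suc 0             = a<c
  φ-suc 1             = ℕ.<-≤-trans c<b (ℕ.m≤m+n b 0)
  φ-suc (suc (suc n)) = ℕ.+-monoʳ-< b ℕ.≤-refl

contains-1110 : ∀ {x y π} → y < x → (x ∷ x ∷ x ∷ y ∷ []) ⊆ π → π Contains (1 ∷ 1 ∷ 1 ∷ 0 ∷ [])
contains-1110 {x} {y} y<x p = map-⊆⇒Contains φ φ-suc (1 ∷ 1 ∷ 1 ∷ 0 ∷ [])
  (subst (λ z → (z ∷ z ∷ z ∷ y ∷ []) ⊆ _) (sym (ℕ.+-identityʳ x)) p)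
  where
  φ : ℕ → ℕ
  φ zero    = y
  φ (suc n) = x ℕ.+ n
  φ-suc : ∀ n → φ n < φ (suc n)
  φ-suc zero    = ℕ.<-≤-trans y<x (ℕ.m≤m+n x 0)
  φ-suc (suc n) = ℕ.+-monoʳ-< x ℕ.≤-refl

-- The leading 0 can always play the smallest letter, and the other two letters of an occurrence are
-- positive and lie in `w`.
avoids-021⇔ : ∀ w → (0 ∷ w) Avoids (0 ∷ 2 ∷ 1 ∷ []) ⇔ Noninversion w
avoids-021⇔ w = mk⇔ forth back
  where
  forth : (0 ∷ w) Avoids (0 ∷ 2 ∷ 1 ∷ []) → Noninversion w
  forth av 0<c c<b p = av (contains-021 0<c c<b (refl ∷ p))
  back : Noninversion w → (0 ∷ w) Avoids (0 ∷ 2 ∷ 1 ∷ [])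
  back ni (is@(i ∷ j ∷ k ∷ []) , inc , iso) =
    ni (ℕ.≤-<-trans z≤n a<c) c<b (∷⁻ (entries-⊆ (0 ∷ w) is inc))
    where
    a<c = from (proj₁ (iso 0F 2F)) (s≤s z≤n)
    c<b = from (proj₁ (iso 2F 1F)) (s≤s (s≤s z≤n))

-- The first letter of an occurrence exceeds its last, so it cannot be the leading 0.
avoids-1110⇔ : ∀ w → (0 ∷ w) Avoids (1 ∷ 1 ∷ 1 ∷ 0 ∷ []) ⇔ Nontriple w
avoids-1110⇔ w = mk⇔ forth back
  where
  forth : (0 ∷ w) Avoids (1 ∷ 1 ∷ 1 ∷ 0 ∷ []) → Nontriple w
  forth av y<x p = av (contains-1110 y<x (0 ∷ʳ p))
  drop-0 : ∀ {x y} → y < x → (x ∷ x ∷ x ∷ y ∷ []) ⊆ (0 ∷ w) → (x ∷ x ∷ x ∷ y ∷ []) ⊆ w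
  drop-0 _  (_ ∷ʳ p)  = p
  drop-0 () (refl ∷ _)
  back : Nontriple w → (0 ∷ w) Avoids (1 ∷ 1 ∷ 1 ∷ 0 ∷ [])
  back nt (is@(i ∷ j ∷ k ∷ l ∷ []) , inc , iso) = nt y<x (drop-0 y<x
    (subst₂ (λ x′ x″ → (_ ∷ x′ ∷ x″ ∷ _ ∷ []) ⊆ (0 ∷ w)) (same 1F refl) (same 2F refl)
      (entries-⊆ (0 ∷ w) is inc)))
    where
    y<x = from (proj₁ (iso 3F 0F)) (s≤s z≤n)
    same : ∀ m → lookup (1 ∷ 1 ∷ 1 ∷ 0 ∷ []) m ≡ 1 →
           lookup (0 ∷ w) (Vec.lookup is m) ≡ lookup (0 ∷ w) i
    same m = from (proj₂ (iso m 0F))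

-- Runs of the transition system

-- l and m are the last entry and the number of ascents of what precedes w.
AscentsFrom : ℕ → ℕ → List ℕ → Set
AscentsFrom l m []      = ⊤
AscentsFrom l m (x ∷ w) = x ≤ suc m × AscentsFrom x ((if l <ᵇ x then 1 else 0) ℕ.+ m) w

-- `AscentsFrom` accumulates the ascents that the definition recounts for every prefix.
ascentsFrom⇔ : ∀ l m w → (∀ i → lookup w i ≤ m ℕ.+ asc (l ∷ take (toℕ i) w) ℕ.+ 1) ⇔ AscentsFrom l m w
ascentsFrom⇔ l m w = mk⇔ (forth l m w) (back l m w)
  where
  shift : ∀ l x m n → m ℕ.+ ((if l <ᵇ x then 1 else 0) ℕ.+ n) ℕ.+ 1
                    ≡ (if l <ᵇ x then 1 else 0) ℕ.+ m ℕ.+ n ℕ.+ 1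
  shift l x m n = cong (ℕ._+ 1) (trans (sym (ℕ.+-assoc m bit n)) (cong (ℕ._+ n) (ℕ.+-comm m bit)))
    where bit = if l <ᵇ x then 1 else 0
  first : ∀ m → m ℕ.+ 0 ℕ.+ 1 ≡ suc m
  first m = trans (cong (ℕ._+ 1) (ℕ.+-identityʳ m)) (ℕ.+-comm m 1)
  forth : ∀ l m w → (∀ i → lookup w i ≤ m ℕ.+ asc (l ∷ take (toℕ i) w) ℕ.+ 1) → AscentsFrom l m w
  forth l m []      _     = tt
  forth l m (x ∷ w) bound = subst (x ≤_) (first m) (bound 0F) ,
    forth x _ w λ i → subst (lookup w i ≤_) (shift l x m _) (bound (Fin.suc i))
  back : ∀ l m w → AscentsFrom l m w → ∀ i → lookup w i ≤ m ℕ.+ asc (l ∷ take (toℕ i) w) ℕ.+ 1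
  back l m (x ∷ w) (x≤ , _) 0F          = subst (x ≤_) (sym (first m)) x≤
  back l m (x ∷ w) (_ , as) (Fin.suc i) =
    subst (lookup w i ≤_) (sym (shift l x m _)) (back x _ w as i)

isAscentSequence⇔ : ∀ w → IsAscentSequence (0 ∷ w) ⇔ AscentsFrom 0 0 w
isAscentSequence⇔ w = mk⇔
  (λ a → to (ascentsFrom⇔ 0 0 w) λ i → proj₂ (a (Fin.suc i)) (s≤s z≤n))
  (λ as → λ { 0F → (λ _ → refl) , λ () ; (Fin.suc i) → (λ ()) , λ _ → from (ascentsFrom⇔ 0 0 w) as i })

<ᵇ-true : ∀ {m n} → m < n → (m <ᵇ n) ≡ true
<ᵇ-true {zero}  {suc n} _         = refl
<ᵇ-true {suc m} {suc n} (s≤s m<n) = <ᵇ-true m<n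

<ᵇ-irrefl : ∀ m → (m <ᵇ m) ≡ false
<ᵇ-irrefl zero    = refl
<ᵇ-irrefl (suc m) = <ᵇ-irrefl m

-- Effect of a single entry on avoidance

Good : List ℕ → Set
Good w = Noninversion w × Nontriple w

good-⊆ : ∀ {us ws} → us ⊆ ws → Good ws → Good us
good-⊆ p (ni , nt) = (λ 0<c c<b q → ni 0<c c<b (⊆-trans q p)) , (λ y<x q → nt y<x (⊆-trans q p))

all-take : ∀ {P : ℕ → Set} k xs → All P (take (suc k) xs) → All P (take k xs)
all-take zero    xs       _        = []
all-take (suc k) []       _        = []
all-take (suc k) (x ∷ xs) (p ∷ ps) = p ∷ all-take k xs ps

-- us is too short to absorb the positive initial entries of xs, so the 0 is
-- never used by an embedding of xs.
skip-zero : ∀ us {w} xs → All (0 <_) (take (suc (length us)) xs) →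
            xs ⊆ us ++ 0 ∷ w → xs ⊆ us ++ w
skip-zero us       []       _        _          = minimum _
skip-zero []       (x ∷ xs) _        (_ ∷ʳ p)   = p
skip-zero []       (x ∷ xs) (() ∷ _) (refl ∷ p)
skip-zero (u ∷ us) (x ∷ xs) pos      (_ ∷ʳ p)   =
  _ ∷ʳ skip-zero us (x ∷ xs) (all-take (suc (length us)) (x ∷ xs) pos) p
skip-zero (u ∷ us) (x ∷ xs) (_ ∷ ps) (refl ∷ p) = refl ∷ skip-zero us xs ps p

-- Both entries of a forbidden pair are positive, and a 0 can end a forbidden quadruple only after
-- three equal positive entries, for which `us` is too short.
good-zero : ∀ us {w} → length us ≤ 2 → Good (us ++ w) → Good (us ++ 0 ∷ w)
good-zero us {w} ≤2 (ni , nt) = ni′ , nt′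
  where
  positive : ∀ {x y} k → k ≤ 2 → 0 < x → All (0 <_) (take (suc k) (x ∷ x ∷ x ∷ y ∷ []))
  positive 0 _ p = p ∷ []
  positive 1 _ p = p ∷ p ∷ []
  positive 2 _ p = p ∷ p ∷ p ∷ []
  positive (suc (suc (suc _))) (s≤s (s≤s ())) _

  ni′ : Noninversion (us ++ 0 ∷ w)
  ni′ {b} {c} 0<c c<b p = ni 0<c c<b (skip-zero us _
    (All.take⁺ _ (ℕ.<-trans 0<c c<b ∷ 0<c ∷ [])) p)

  nt′ : Nontriple (us ++ 0 ∷ w)
  nt′ {x} {y} y<x p = nt y<x (skip-zero us _
    (positive (length us) ≤2 (ℕ.≤-<-trans z≤n y<x)) p)

-- A smaller positive entry after `v` cannot be `x`, and if it comes later it is already forbidden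
-- after `x`.
noninversion-∷ : ∀ {v x w} → v ≤ x → Noninversion (x ∷ w) → Noninversion (v ∷ x ∷ w)
noninversion-∷ v≤x ni 0<c c<b (_ ∷ʳ p)          = ni 0<c c<b p
noninversion-∷ v≤x ni 0<c c<v (refl ∷ _ ∷ʳ p)   = ni 0<c (ℕ.<-≤-trans c<v v≤x) (refl ∷ p)
noninversion-∷ v≤x ni 0<c c<v (refl ∷ refl ∷ p) = contradiction v≤x (ℕ.<⇒≱ c<v)

noninversion-tail : ∀ {v w} → Noninversion (v ∷ w) → Noninversion w
noninversion-tail ni 0<c c<b p = ni 0<c c<b (_ ∷ʳ p)

smaller-absent : ∀ {v x w ys} → 0 < v → v < x → Noninversion (x ∷ w) → ¬ (v ∷ ys) ⊆ (x ∷ w)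
smaller-absent 0<v v<x ni (_ ∷ʳ p)   = ni 0<v v<x (refl ∷ ⊆-trans (refl ∷ minimum _) p)
smaller-absent 0<v v<x ni (refl ∷ _) = ℕ.<-irrefl refl v<x

-- Once exceeded, `v` never recurs, so its two copies cannot become three. This is why a jump may
-- forget the old maximum.
good-jump : ∀ {v x w} → 0 < v → v < x → Good (x ∷ w) → Good (v ∷ v ∷ x ∷ w)
good-jump {v} {x} {w} 0<v v<x (ni , nt) =
  noninversion-∷ ℕ.≤-refl (noninversion-∷ (ℕ.<⇒≤ v<x) ni) , nt′
  where
  nt′ : Nontriple (v ∷ v ∷ x ∷ w)
  nt′ y<a (_ ∷ʳ _ ∷ʳ p)   = nt y<a p
  nt′ y<a (_ ∷ʳ refl ∷ p) = smaller-absent 0<v v<x ni p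
  nt′ y<a (refl ∷ p)      = smaller-absent 0<v v<x ni (∷⁻ p)

-- The last entry of a forbidden quadruple is either 0, or positive and then the end of a forbidden
-- pair.
good-triple⇔ : ∀ {v w} → 0 < v → Good (v ∷ v ∷ v ∷ w) ⇔ (Noninversion (v ∷ w) × ¬ (0 ∷ []) ⊆ w)
good-triple⇔ {v} {w} 0<v = mk⇔
  (λ (ni , nt) → noninversion-tail (noninversion-tail ni) ,
                 λ p → nt 0<v (refl ∷ refl ∷ refl ∷ p))
  (λ (ni , no0) → ni³ ni , nt ni no0)
  where
  ni³ : Noninversion (v ∷ w) → Noninversion (v ∷ v ∷ v ∷ w)
  ni³ ni = noninversion-∷ ℕ.≤-refl (noninversion-∷ ℕ.≤-refl ni)

  no0³ : ¬ (0 ∷ []) ⊆ w → ¬ (0 ∷ []) ⊆ (v ∷ v ∷ v ∷ w)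
  no0³ no0 p = no0 (skip (skip (skip p)))
    where
    skip : ∀ {w} → (0 ∷ []) ⊆ (v ∷ w) → (0 ∷ []) ⊆ w
    skip (_ ∷ʳ p)   = p
    skip (refl ∷ _) = contradiction 0<v λ ()

  nt : Noninversion (v ∷ w) → ¬ (0 ∷ []) ⊆ w → Nontriple (v ∷ v ∷ v ∷ w)
  nt ni no0 {y = zero}  y<a p = no0³ no0 (∷ˡ⁻ (∷ˡ⁻ (∷ˡ⁻ p)))
  nt ni no0 {y = suc y} y<a p = ni³ ni (s≤s z≤n) y<a (∷ˡ⁻ (∷ˡ⁻ p))

-- The continuations allowed after a prefix leading to the state; of the nonzero
-- prefix entries only the copies of the maximum can still matter for Good.
⟦_⟧ : State → List ℕ → Set
⟦ zeros ⟧     w = AscentsFrom 0 0 w × Good w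
⟦ max₁ u e ⟧  w = AscentsFrom (suc u) (suc u ℕ.+ e) w × Good (suc u ∷ w)
⟦ max₂ u e ⟧  w = AscentsFrom (suc u) (suc u ℕ.+ e) w × Good (suc u ∷ suc u ∷ w)
⟦ max₃ u e ⟧  w = AscentsFrom (suc u) (suc u ℕ.+ e) w × Noninversion (suc u ∷ w) × ¬ (0 ∷ []) ⊆ w
⟦ zero₁ u e ⟧ w = AscentsFrom 0 (suc u ℕ.+ e) w × Good (suc u ∷ w)
⟦ zero₂ u e ⟧ w = AscentsFrom 0 (suc u ℕ.+ e) w × Good (suc u ∷ suc u ∷ w)

Accepts : List (ℕ × State) → ℕ → List ℕ → Set
Accepts ms x w = Any (λ (y , t) → y ≡ x × ⟦ t ⟧ w) ms

module _ (s : ℕ → ℕ → State) (T : ℕ → ℕ → List ℕ → Set)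
         (s≡T : ∀ u e w → ⟦ s u e ⟧ w ≡ T (suc u) (suc u ℕ.+ e) w) where

  -- All jumps lead to the same number of ascents, so `T` takes that number in place of the excess;
  -- the recursion keeps `v + e` fixed.
  jumps⇔ : ∀ v e {x w} →
           Accepts (jumps s v e) x w ⇔ (v < x × x ≤ suc (v ℕ.+ e) × T x (suc (v ℕ.+ e)) w)
  jumps⇔ v e = mk⇔ (forth v e) (λ (v<x , x≤ , t) → back v e v<x x≤ t)
    where
    forth : ∀ v e {x w} → Accepts (jumps s v e) x w →
            v < x × x ≤ suc (v ℕ.+ e) × T x (suc (v ℕ.+ e)) w
    forth v zero    {w = w} (here (refl , t)) =
      ℕ.≤-refl , s≤s (ℕ.m≤m+n v 0) , subst id (s≡T v 0 w) t
    forth v (suc e) {w = w} (here (refl , t)) =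
      ℕ.≤-refl , s≤s (ℕ.m≤m+n v _) , subst id (s≡T v (suc e) w) t
    forth v (suc e) {x} {w} (there p) with v<x , x≤ , t ← forth (suc v) e p =
      ℕ.<-trans (ℕ.n<1+n v) v<x ,
      subst (λ m → x ≤ suc m × T x (suc m) w) (sym (ℕ.+-suc v e)) (x≤ , t)
    back : ∀ v e {x w} → v < x → x ≤ suc (v ℕ.+ e) → T x (suc (v ℕ.+ e)) w → Accepts (jumps s v e) x w
    back v zero {x} {w} v<x x≤ t
      with refl ← ℕ.≤-antisym v<x (subst (λ m → x ≤ suc m) (ℕ.+-identityʳ v) x≤) =
      here (refl , subst id (sym (s≡T v 0 w)) t)
    back v (suc e) {x} {w} v<x x≤ t with ℕ.m≤n⇒m<n∨m≡n v<x
    ... | inj₂ refl  = here (refl , subst id (sym (s≡T v (suc e) w)) t)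
    ... | inj₁ v+1<x = there (back (suc v) e v+1<x
      (subst (λ m → x ≤ suc m) (ℕ.+-suc v e) x≤)
      (subst (λ m → T x (suc m) w) (ℕ.+-suc v e) t))

jumps-max₁⇔ = jumps⇔ max₁ (λ x m w → AscentsFrom x m w × Good (x ∷ w)) (λ _ _ _ → refl)

jumps-max₃⇔ = jumps⇔ max₃
  (λ x m w → AscentsFrom x m w × Noninversion (x ∷ w) × ¬ (0 ∷ []) ⊆ w) (λ _ _ _ → refl)

ascentsFrom-up : ∀ {l x m w} → l < x →
                 AscentsFrom x ((if l <ᵇ x then 1 else 0) ℕ.+ m) w ≡ AscentsFrom x (suc m) w
ascentsFrom-up l<x rewrite <ᵇ-true l<x = refl

ascentsFrom-same : ∀ l {m w} → AscentsFrom l ((if l <ᵇ l then 1 else 0) ℕ.+ m) w ≡ AscentsFrom l m w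
ascentsFrom-same l rewrite <ᵇ-irrefl l = refl

-- The common step of the four states with a positive maximum and no tripled value: `us` holds the
-- one or two copies of the maximum, and `t₀` and `t₁` are the states after a 0 and after a further
-- copy.
module _ (l u e : ℕ) (us : List ℕ) (t₀ t₁ : State)
  (l≤ : l ≤ suc u) (≤2 : length us ≤ 2)
  (max∈us : (suc u ∷ []) ⊆ us) (us⊆max² : us ⊆ (suc u ∷ suc u ∷ []))
  (t₀⇔ : ∀ w → (AscentsFrom 0 (suc u ℕ.+ e) w × Good (us ++ w)) ⇔ ⟦ t₀ ⟧ w)
  (t₁⇔ : ∀ w → (AscentsFrom (suc u) ((if l <ᵇ suc u then 1 else 0) ℕ.+ (suc u ℕ.+ e)) w
                × Good (us ++ suc u ∷ w)) ⇔ ⟦ t₁ ⟧ w)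
  where

  nontripled-step⇔ : ∀ x w → (AscentsFrom l (suc u ℕ.+ e) (x ∷ w) × Good (us ++ x ∷ w))
                           ⇔ Accepts ((0 , t₀) ∷ (suc u , t₁) ∷ jumps max₁ (suc u) e) x w
  nontripled-step⇔ x w = mk⇔ (forth x) back
    where
    forth : ∀ x → AscentsFrom l (suc u ℕ.+ e) (x ∷ w) × Good (us ++ x ∷ w) →
            Accepts ((0 , t₀) ∷ (suc u , t₁) ∷ jumps max₁ (suc u) e) x w
    forth zero      ((_ , as) , g) =
      here (refl , to (t₀⇔ w) (as , good-⊆ (++⁺ (⊆-refl {x = us}) (0 ∷ʳ ⊆-refl)) g))
    forth x@(suc _) ((x≤ , as) , g) with ℕ.<-cmp x (suc u)
    -- A positive entry below the maximum forms a forbidden pair with a copy of it.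
    ... | tri< x<v _ _  = contradiction (++⁺ max∈us (refl ∷ minimum w)) (proj₁ g (s≤s z≤n) x<v)
    ... | tri≈ _ refl _ = there (here (refl , to (t₁⇔ w) (as , g)))
    ... | tri> _ _ v<x  = there (there (from (jumps-max₁⇔ (suc u) e)
      (v<x , x≤ , subst id (ascentsFrom-up {w = w} (ℕ.≤-<-trans l≤ v<x)) as ,
       good-⊆ (++⁺ (minimum us) ⊆-refl) g)))

    back : ∀ {x} → Accepts ((0 , t₀) ∷ (suc u , t₁) ∷ jumps max₁ (suc u) e) x w →
           AscentsFrom l (suc u ℕ.+ e) (x ∷ w) × Good (us ++ x ∷ w)
    back (here (refl , r)) with as , g ← from (t₀⇔ w) r = (z≤n , as) , good-zero us ≤2 g
    back (there (here (refl , r))) with as , g ← from (t₁⇔ w) r =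
      (s≤s (ℕ.≤-trans (ℕ.m≤m+n u e) (ℕ.n≤1+n _)) , as) , g
    -- Two copies of the old maximum may be restored before a jump, and `us` is a sublist of them.
    back (there (there j)) with v<x , x≤ , as , g ← to (jumps-max₁⇔ (suc u) e) j =
      (x≤ , subst id (sym (ascentsFrom-up {w = w} (ℕ.≤-<-trans l≤ v<x))) as) ,
      good-⊆ (++⁺ us⊆max² ⊆-refl) (good-jump (s≤s z≤n) v<x g)

step⇔ : ∀ s x w → ⟦ s ⟧ (x ∷ w) ⇔ Accepts (moves s) x w
step⇔ zeros x w = mk⇔ (forth x) back
  where
  forth : ∀ x → ⟦ zeros ⟧ (x ∷ w) → Accepts (moves zeros) x w
  forth zero    ((_ , as) , g)  = here (refl , as , good-⊆ (0 ∷ʳ ⊆-refl) g)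
  forth (suc x) ((x≤ , as) , g) = there (from (jumps-max₁⇔ 0 0) (s≤s z≤n , x≤ , as , g))
  back : ∀ {x} → Accepts (moves zeros) x w → ⟦ zeros ⟧ (x ∷ w)
  back (here (refl , as , g)) = (z≤n , as) , good-zero [] z≤n g
  back (there j) with s≤s _ , x≤ , as , g ← to (jumps-max₁⇔ 0 0) j = (x≤ , as) , g
step⇔ (max₁ u e) = nontripled-step⇔ (suc u) u e (suc u ∷ []) (zero₁ u e) (max₂ u e)
  ℕ.≤-refl (s≤s z≤n) ⊆-refl (refl ∷ minimum _) (λ _ → ⇔-refl)
  (λ w → mk⇔ (λ (as , g) → subst id (ascentsFrom-same (suc u) {w = w}) as , g)
              (λ (as , g) → subst id (sym (ascentsFrom-same (suc u) {w = w})) as , g))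
step⇔ (max₂ u e) = nontripled-step⇔ (suc u) u e (suc u ∷ suc u ∷ []) (zero₂ u e) (max₃ u e)
  ℕ.≤-refl (s≤s (s≤s z≤n)) (refl ∷ minimum _) ⊆-refl (λ _ → ⇔-refl)
  (λ w → mk⇔ (λ (as , g) → subst id (ascentsFrom-same (suc u) {w = w}) as ,
                           to (good-triple⇔ (s≤s z≤n)) g)
              (λ (as , g) → subst id (sym (ascentsFrom-same (suc u) {w = w})) as ,
                           from (good-triple⇔ (s≤s z≤n)) g))
step⇔ (zero₁ u e) = nontripled-step⇔ 0 u e (suc u ∷ []) (zero₁ u e) (max₂ u (suc e))
  z≤n (s≤s z≤n) ⊆-refl (refl ∷ minimum _) (λ _ → ⇔-refl)
  (λ w → mk⇔ (λ (as , g) → subst (λ m → AscentsFrom (suc u) m w) (sym (ℕ.+-suc (suc u) e)) as , g)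
              (λ (as , g) → subst (λ m → AscentsFrom (suc u) m w) (ℕ.+-suc (suc u) e) as , g))
step⇔ (zero₂ u e) = nontripled-step⇔ 0 u e (suc u ∷ suc u ∷ []) (zero₂ u e) (max₃ u (suc e))
  z≤n (s≤s (s≤s z≤n)) (refl ∷ minimum _) ⊆-refl (λ _ → ⇔-refl)
  (λ w → mk⇔ (λ (as , g) → subst (λ m → AscentsFrom (suc u) m w) (sym (ℕ.+-suc (suc u) e)) as ,
                           to (good-triple⇔ (s≤s z≤n)) g)
              (λ (as , g) → subst (λ m → AscentsFrom (suc u) m w) (ℕ.+-suc (suc u) e) as ,
                           from (good-triple⇔ (s≤s z≤n)) g))
step⇔ (max₃ u e) x w = mk⇔ (forth x) back
  where
  v = suc u
  forth : ∀ x → ⟦ max₃ u e ⟧ (x ∷ w) → Accepts (moves (max₃ u e)) x w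
  forth zero      (_ , _ , no0) = contradiction (refl ∷ minimum w) no0
  forth x@(suc _) ((x≤ , as) , ni , no0) with ℕ.<-cmp x v
  ... | tri< x<v _ _  = contradiction (refl ∷ refl ∷ minimum w) (ni (s≤s z≤n) x<v)
  ... | tri≈ _ refl _ = here (refl , subst id (ascentsFrom-same v {w = w}) as ,
                              noninversion-tail ni , no0 ∘ (x ∷ʳ_))
  ... | tri> _ _ v<x  = there (from (jumps-max₃⇔ v e)
    (v<x , x≤ , subst id (ascentsFrom-up {w = w} v<x) as , noninversion-tail ni , no0 ∘ (x ∷ʳ_)))

  no0-∷ : ∀ {x} → 0 < x → ¬ (0 ∷ []) ⊆ w → ¬ (0 ∷ []) ⊆ (x ∷ w)
  no0-∷ _   no0 (_ ∷ʳ p)   = no0 p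
  no0-∷ 0<x no0 (refl ∷ _) = contradiction 0<x λ ()

  back : ∀ {x} → Accepts (moves (max₃ u e)) x w → ⟦ max₃ u e ⟧ (x ∷ w)
  back (here (refl , as , ni , no0)) =
    (s≤s (ℕ.≤-trans (ℕ.m≤m+n u e) (ℕ.n≤1+n _)) , subst id (sym (ascentsFrom-same v {w = w})) as) ,
    noninversion-∷ ℕ.≤-refl ni , no0-∷ (s≤s z≤n) no0
  back (there j) with v<x , x≤ , as , ni , no0 ← to (jumps-max₃⇔ v e) j =
    (x≤ , subst id (sym (ascentsFrom-up {w = w} v<x)) as) ,
    noninversion-∷ (ℕ.<⇒≤ v<x) ni , no0-∷ (ℕ.≤-<-trans z≤n v<x) no0

-- Covers the empty continuation in every state, as none remembers more than two entries.
good-pair : ∀ v → Good (v ∷ v ∷ [])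
good-pair v =
  noninversion-∷ ℕ.≤-refl (λ _ _ p → contradiction (length-mono-≤ p) λ { (s≤s ()) }) ,
  λ _ p → contradiction (length-mono-≤ p) λ { (s≤s (s≤s ())) }

⟦⟧-[] : ∀ s → ⟦ s ⟧ []
⟦⟧-[] zeros       = tt , good-⊆ (minimum _) (good-pair 0)
⟦⟧-[] (max₁ u e)  = tt , good-⊆ (refl ∷ minimum _) (good-pair (suc u))
⟦⟧-[] (max₂ u e)  = tt , good-pair (suc u)
⟦⟧-[] (max₃ u e)  = tt , noninversion-tail (proj₁ (good-pair (suc u))) , λ ()
⟦⟧-[] (zero₁ u e) = tt , good-⊆ (refl ∷ minimum _) (good-pair (suc u))
⟦⟧-[] (zero₂ u e) = tt , good-pair (suc u)

∈-runs⇔ : ∀ s n w → w ∈ runs s n ⇔ (length w ≡ n × ⟦ s ⟧ w)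
∈-runs⇔ s zero    []      = mk⇔ (λ _ → refl , ⟦⟧-[] s) (λ _ → here refl)
∈-runs⇔ s zero    (x ∷ w) = mk⇔ (λ { (here ()) ; (there ()) }) λ ()
∈-runs⇔ s (suc n) w       = mk⇔ (forth w ∘ ∈-concatMap⁻ (branch n)) (back w)
  where
  forth : ∀ w → Any ((w ∈_) ∘ branch n) (moves s) → length w ≡ suc n × ⟦ s ⟧ w
  forth []      p with _ , q ← Any.satisfied p with _ , _ , () ← ∈-map⁻ _ q
  forth (x ∷ w) p =
    cong suc (let _ , _ , q = Any.satisfied (Any.map ∈-branch p) in proj₁ (to (∈-runs⇔ _ n w) q)) ,
    from (step⇔ s x w) (Any.map (λ q → map₂ (proj₂ ∘ to (∈-runs⇔ _ n w)) (∈-branch q)) p)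
    where
    ∈-branch : ∀ {y t} → (x ∷ w) ∈ branch n (y , t) → y ≡ x × w ∈ runs t n
    ∈-branch q with _ , q′ , refl ← ∈-map⁻ _ q = refl , q′
  back : ∀ w → length w ≡ suc n × ⟦ s ⟧ w → w ∈ runs s (suc n)
  back (x ∷ w) (eq , r) = ∈-concatMap⁺ (branch n) (Any.map
    (λ { (refl , r′) → ∈-map⁺ (x ∷_) (from (∈-runs⇔ _ n w) (ℕ.suc-injective eq , r′)) })
    (to (step⇔ s x w) r))

-- Absence of repeated runs

jumps-> : ∀ s {k} v e → k ≤ v → All (λ (y , _) → k < y) (jumps s v e)
jumps-> s v zero    k≤v = s≤s k≤v ∷ []
jumps-> s v (suc e) k≤v = s≤s k≤v ∷ jumps-> s (suc v) e (ℕ.m≤n⇒m≤1+n k≤v)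

-- Distinct moves read distinct entries: the system is deterministic, so no word arises from two
-- runs.
moves-ascending : ∀ s → AllPairs (λ (x , _) (y , _) → x < y) (moves s)
moves-ascending = λ where
    zeros       → jumps-> max₁ 0 0 z≤n ∷ ascending max₁ 0 0
    (max₁ u e)  → zero∷max∷ u e
    (max₂ u e)  → zero∷max∷ u e
    (max₃ u e)  → jumps-> max₃ (suc u) e ℕ.≤-refl ∷ ascending max₃ (suc u) e
    (zero₁ u e) → zero∷max∷ u e
    (zero₂ u e) → zero∷max∷ u e
  where
  ascending : ∀ s v e → AllPairs (λ (x , _) (y , _) → x < y) (jumps s v e)
  ascending s v zero    = [] ∷ []
  ascending s v (suc e) = jumps-> s (suc v) e ℕ.≤-refl ∷ ascending s (suc v) e

  zero∷max∷ : ∀ u e {s t} → AllPairs (λ (x , _) (y , _) → x < y)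
                              ((0 , s) ∷ (suc u , t) ∷ jumps max₁ (suc u) e)
  zero∷max∷ u e = (s≤s z≤n ∷ jumps-> max₁ (suc u) e z≤n) ∷
    jumps-> max₁ (suc u) e ℕ.≤-refl ∷ ascending max₁ (suc u) e

runs-unique : ∀ s n → Unique (runs s n)
runs-unique s zero    = [] ∷ []
runs-unique s (suc n) = Unique.concat⁺
  (All.map⁺ (All.universal (λ (x , t) → Unique.map⁺ List.∷-injectiveʳ (runs-unique t n)) (moves s)))
  (AllPairs.map⁺ (AllPairs.map disjoint (moves-ascending s)))
  where
  disjoint : ∀ {m m′ : ℕ × State} → proj₁ m < proj₁ m′ → Disjoint (branch n m) (branch n m′)
  disjoint x<y (p , q) with _ , _ , refl ← ∈-map⁻ _ p with _ , _ , refl ← ∈-map⁻ _ q =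
    ℕ.<-irrefl refl x<y

-- From ascent sequences to runs

B⇔ : ∀ n x w → B (1 ∷ 1 ∷ 1 ∷ 0 ∷ []) (suc n) (x ∷ w) ⇔ (x ≡ 0 × length w ≡ n × ⟦ zeros ⟧ w)
B⇔ n x w = mk⇔ forth back
  where
  forth : B (1 ∷ 1 ∷ 1 ∷ 0 ∷ []) (suc n) (x ∷ w) → x ≡ 0 × length w ≡ n × ⟦ zeros ⟧ w
  forth (refl , a , av , av′) with refl ← proj₁ (a 0F) refl =
    refl , refl , to (isAscentSequence⇔ w) a , to (avoids-021⇔ w) av , to (avoids-1110⇔ w) av′
  back : x ≡ 0 × length w ≡ n × ⟦ zeros ⟧ w → B (1 ∷ 1 ∷ 1 ∷ 0 ∷ []) (suc n) (x ∷ w)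
  back (refl , refl , as , ni , nt) =
    refl , from (isAscentSequence⇔ w) as , from (avoids-021⇔ w) ni , from (avoids-1110⇔ w) nt

-- Two lists without repetition and with the same members are permutations of each other.
length-B : ∀ n xs → Unique xs → (∀ w → w ∈ xs ⇔ B (1 ∷ 1 ∷ 1 ∷ 0 ∷ []) (suc n) w) →
           length xs ≡ length (runs zeros n)
length-B n xs unique ∈-xs⇔ = trans
  (↭-length (∼bag⇒↭ (unique∧set⇒bag unique
    (Unique.map⁺ List.∷-injectiveʳ (runs-unique zeros n)) (λ {w} → mk⇔ (forth w) (back w)))))
  (List.length-map (0 ∷_) (runs zeros n))
  where
  forth : ∀ w → w ∈ xs → w ∈ map (0 ∷_) (runs zeros n)
  forth []      p with () , _ ← to (∈-xs⇔ []) p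
  forth (x ∷ w) p with refl , r ← to (B⇔ n x w) (to (∈-xs⇔ (x ∷ w)) p) =
    ∈-map⁺ (0 ∷_) (from (∈-runs⇔ zeros n w) r)
  back : ∀ w → w ∈ map (0 ∷_) (runs zeros n) → w ∈ xs
  back w p with w′ , q , refl ← ∈-map⁻ (0 ∷_) p =
    from (∈-xs⇔ w) (from (B⇔ n 0 w′) (refl , to (∈-runs⇔ zeros n w′) q))

b-suc : ∀ n → b (1 ∷ 1 ∷ 1 ∷ 0 ∷ []) (suc n) ≡ length (runs zeros n)
b-suc n = length-B n (B-list (1 ∷ 1 ∷ 1 ∷ 0 ∷ []) (suc n))
  (B-list-unique (1 ∷ 1 ∷ 1 ∷ 0 ∷ []) (suc n)) (∈-B-list (1 ∷ 1 ∷ 1 ∷ 0 ∷ []) (suc n))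

-- The constant 1 counts the empty sequence, and the factor `X` the compulsory leading 0.
b-series : generatingFunction (b (1 ∷ 1 ∷ 1 ∷ 0 ∷ [])) ≗ const 1ℤ ⊕ X ⊛ G zeros
b-series zero    = refl
b-series (suc n) = begin
  + b (1 ∷ 1 ∷ 1 ∷ 0 ∷ []) (suc n)  ≡⟨ cong +_ (b-suc n) ⟩
  + length (runs zeros n)           ≡⟨ length-runs zeros n ⟩
  G zeros n                         ≡⟨ X-⊛-suc (G zeros) n ⟨
  (X ⊛ G zeros) (suc n)             ≡⟨ ℤ.+-identityˡ _ ⟨
  0ℤ ℤ.+ (X ⊛ G zeros) (suc n)      ∎
  where open ≡-Reasoning

theorem3p6 : ∃[ r ]
    (r IsSqrtOf poly (+ 1 ∷ - + 4 ∷ + 2 ∷ + 0 ∷ + 1 ∷ [])) ×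
    (generatingFunction (b (1 ∷ 1 ∷ 1 ∷ 0 ∷ []))
    IsQuotientOf
    (poly (+ 1 ∷ - + 5 ∷ + 8 ∷ - + 5 ∷ + 1 ∷ [])
    ⊖ poly (+ 1 ∷ - + 3 ∷ + 1 ∷ + 2 ∷ []) ⊛ r)
    By
    (poly (+ 0 ∷ + 0 ∷ + 2 ∷ [])
    ⊛ (poly (+ 1 ∷ - + 2 ∷ []) ⊛ poly (+ 1 ∷ - + 2 ∷ []))))
theorem3p6 = root , root-isSqrt , isQuotient _ b-series
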